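{- Let $n>k>t>j\ge1$ be integers with $n\ge(k-t+1)(t+1)$. Suppose that $\mathcal F\subset\binom{[n]}{k}$ is shifted and $t$-intersecting, $\mathcal F\not\subset\mathcal A_1$, and $b_{t+1}\ge t+1$. Then $$|\partial^j\mathcal F|>\binom{t}{j}|\mathcal F|.$$
   Context: $[n]=\{1,\dots,n\}$, and $\binom{[n]}{k}$ is the collection of all $k$-element subsets of $[n]$. A family $\mathcal F\subset\binom{[n]}{k}$ is $t$-intersecting if $|F\cap F'|\ge t$ for all $F,F'\in\mathcal F$. The $j$'th shadow is $\partial^j\mathcal F=\{G\in\binom{[n]}{k-j} : \exists F\in\mathcal F,\ G\subset F\}$. Shifted: for $k$-sets $A=\{a_1<\dots<a_k\}$, $B=\{b_1<\dots<b_k\}$ write $A\prec B$ iff $a_i\le b_i$ for all $1\le i\le k$; $\mathcal F$ is shifted if $A\prec B$ and $B\in\mathcal F$ always imply $A\in\mathcal F$. $\mathcal A_1=\{A\in\binom{[n]}{k}: |A\cap[t+2]|\ge t+1\}$. The base of $\mathcal F$ is $\mathcal B=\{F\cap[2k-t]:F\in\mathcal F\}$ (as a set of sets, without multiplicity), and $b_\ell=|\{B\in\mathcal B:|B|=\ell\}|$. -}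

module Defs where

open import Data.Bool.Properties using () renaming (_≟_ to _≟ᵇ_)
open import Data.Fin.Base using (Fin; toℕ) renaming (_≤_ to _≤ᶠ_)
open import Data.Fin.Subset using (Subset; Side; inside; outside; ∣_∣; _∩_)
  renaming (_⊆_ to _⊆ˢ_)
open import Data.Fin.Subset.Properties using (_∈?_; _⊆?_; anySubset?)
open import Data.List.Base using (List; []; _∷_; length; filter; allFin; cartesianProductWith)
import Data.List.Membership.Propositional as List
open import Data.List.Membership.Propositional.Properties using (∈-cartesianProductWith⁺)
open import Data.List.Relation.Binary.Pointwise.Base using (Pointwise)
open import Data.List.Relation.Unary.All using ([]; _∷_)
open import Data.List.Relation.Unary.AllPairs using ([]; _∷_)
open import Data.List.Relation.Unary.Any using (here; there)
open import Data.List.Relation.Unary.Unique.Propositional using (Unique)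
open import Data.List.Relation.Unary.Unique.Propositional.Properties using (cartesianProductWith⁺)
open import Data.Nat.Base using (ℕ; zero; suc; _+_; _*_; _∸_; _≤_)
open import Data.Nat.Properties using (_≟_; _<?_)
open import Data.Product.Base using (∃; _×_)
open import Data.Vec.Base using ([]; _∷_; tabulate)
open import Data.Vec.Properties using (≡-dec; ∷-injective)
open import Level using (0ℓ)
open import Relation.Binary.PropositionalEquality using (_≡_; refl)
open import Relation.Nullary.Decidable using (does; _×-dec_)
open import Relation.Unary using (Pred; Decidable; _∈_)

private
  variable
    n : ℕ

-- The element i : Fin n stands for the integer toℕ i + 1, so Fin n is
-- {1, …, n} and [1… m ] is {1, …, m}, truncated to {1, …, n} if m > n.
[1…_] : ℕ → Subset n
[1… m ] = tabulate λ i → does (toℕ i <? m)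

Family : ℕ → Set₁
Family n = Pred (Subset n) 0ℓ

Layer : ∀ n → ℕ → Family n
Layer n k A = ∣ A ∣ ≡ k

sides : List Side
sides = inside ∷ outside ∷ []

allSubsets : ∀ n → List (Subset n)
allSubsets zero    = [] ∷ []
allSubsets (suc n) = cartesianProductWith _∷_ sides (allSubsets n)

∈-allSubsets : (A : Subset n) → A List.∈ allSubsets n
∈-allSubsets []            = here refl
∈-allSubsets (inside  ∷ A) = ∈-cartesianProductWith⁺ _∷_ {xs = sides} (here refl) (∈-allSubsets A)
∈-allSubsets (outside ∷ A) = ∈-cartesianProductWith⁺ _∷_ {xs = sides} (there (here refl)) (∈-allSubsets A)

allSubsets-unique : ∀ n → Unique (allSubsets n)
allSubsets-unique zero    = [] ∷ []
allSubsets-unique (suc n) =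
  cartesianProductWith⁺ _∷_ ∷-injective (((λ ()) ∷ []) ∷ [] ∷ []) (allSubsets-unique n)

card : {ℱ : Family n} → Decidable ℱ → ℕ
card {n} ℱ? = length (filter ℱ? (allSubsets n))

Intersecting : ℕ → Family n → Set
Intersecting t ℱ = ∀ {F F′} → F ∈ ℱ → F′ ∈ ℱ → t ≤ ∣ F ∩ F′ ∣

-- In increasing order, because allFin n is.
elements : Subset n → List (Fin n)
elements {n} A = filter (_∈? A) (allFin n)

-- Pointwise relates only lists of equal length, so A ≺ B forces ∣ A ∣ ≡ ∣ B ∣.
infix 4 _≺_
_≺_ : Subset n → Subset n → Set
A ≺ B = Pointwise _≤ᶠ_ (elements A) (elements B)

Shifted : Family n → Set
Shifted ℱ = ∀ {A B} → A ≺ B → B ∈ ℱ → A ∈ ℱ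

-- Shadow k j ℱ is the j'th shadow of a family ℱ of k-element sets.
Shadow : ℕ → ℕ → Family n → Family n
Shadow {n} k j ℱ G = G ∈ Layer n (k ∸ j) × ∃ λ F → F ∈ ℱ × G ⊆ˢ F

shadow? : ∀ k j {ℱ : Family n} → Decidable ℱ → Decidable (Shadow k j ℱ)
shadow? k j ℱ? G = (∣ G ∣ ≟ k ∸ j) ×-dec anySubset? λ F → ℱ? F ×-dec (G ⊆? F)

𝒜₁ : ∀ n → ℕ → ℕ → Family n
𝒜₁ n k t A = A ∈ Layer n k × t + 1 ≤ ∣ A ∩ [1… t + 2 ] ∣

Base : ℕ → ℕ → Family n → Family n
Base k t ℱ B = ∃ λ F → F ∈ ℱ × B ≡ F ∩ [1… 2 * k ∸ t ]

BaseLayer : ℕ → ℕ → Family n → ℕ → Family n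
BaseLayer {n} k t ℱ ℓ B = B ∈ Base k t ℱ × B ∈ Layer n ℓ

baseLayer? : ∀ k t {ℱ : Family n} → Decidable ℱ → ∀ ℓ → Decidable (BaseLayer k t ℱ ℓ)
baseLayer? k t ℱ? ℓ B =
  (anySubset? λ F → ℱ? F ×-dec ≡-dec _≟ᵇ_ B (F ∩ [1… 2 * k ∸ t ])) ×-dec (∣ B ∣ ≟ ℓ)

-- The number b_ℓ of ℓ-element sets in the base of ℱ.
b : ∀ k t {ℱ : Family n} → Decidable ℱ → ℕ → ℕ
b k t ℱ? ℓ = card (baseLayer? k t ℱ? ℓ)

{-# OPTIONS --safe #-}

-- Write T = [t], X = [2t+1] and M = [2k-t].  By shiftedness any two members of ℱ meet in at
-- least t elements already inside M.  If some (t+1)-element base set missed an element of T,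
-- compressing it would force ℱ ⊆ 𝒜₁; so each of them is T ∪ {y}, and as there are at least
-- t + 1 of them, some y exceeds 2t.  Shifting y down gives the base sets T ∪ {z} for all
-- z ∈ X ∖ T, and meeting all of these in t elements leaves only two kinds of members F:
-- those containing T and those with |F ∩ X| ≥ 2t.
--
-- For sets F ⊇ T with |F ∩ X| < 2t delete j elements of T; the resulting C(t,j) sets determine F.
-- For sets F with |F ∩ X| ≥ 2t delete j elements of X; this yields at least C(2t,j) sets, each
-- arising from at most j + 1 sets F, and C(2t,j) ≥ 2^j C(t,j) ≥ (j + 1) C(t,j).  The two parts of
-- the shadow are separated by the size of their trace on X.  A set obtained from T ∪ {y} ∪ … by
-- deleting y and only j - 1 elements of T lies in neither part, whence the strict inequality.
module Submission where

open import Defs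
open import Data.Nat.Base using (ℕ; _+_; _*_; _∸_; _≥_; _>_)
open import Data.Nat.Combinatorics using (_C_)
open import Relation.Unary using (Decidable; _⊆_; _⊈_)

open import Algebra.Properties.CommutativeSemigroup using (x∙yz≈y∙xz)
import Data.Bool.Base as Bool
open import Data.Bool.Properties using () renaming (_≟_ to _≟ᵇ_)
open import Data.Empty using (⊥; ⊥-elim)
open import Data.Fin.Base using (Fin; zero; suc; toℕ; fromℕ<) renaming (_≤_ to _≤ᶠ_; _<_ to _<ᶠ_)
import Data.Fin.Properties as Fin
open import Data.Fin.Subset using (Subset; inside; outside; ∣_∣; _∩_; _∪_; _-_; ∁; ⁅_⁆; _⊂_)
  renaming (_∈_ to _∈ˢ_; _∉_ to _∉ˢ_; _⊆_ to _⊆ˢ_)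
open import Data.Fin.Subset.Properties
open import Data.List.Base using (List; []; _∷_; _++_; length; filter; map; tabulate; allFin)
open import Data.List.Properties
  using (length-map; map-tabulate; length-++; ++-identityʳ; filter-++; filter-≐; filter-none;
         filter-some)
open import Data.List.Relation.Binary.Pointwise using (Pointwise; []; _∷_)
import Data.List.Relation.Binary.Pointwise as Pointwise
open import Data.List.Relation.Unary.All using (universal)
import Data.List.Relation.Unary.Any as Any
open import Data.Nat.Base
  using (zero; suc; _≤_; _<_; _^_; _≤′_; ≤′-reflexive; ≤′-step; z≤n; s≤s; s≤s⁻¹)
open import Data.Nat.Combinatorics
  using (nCk+nC[k+1]≡[n+1]C[k+1]; nCk≡nC[n∸k]; nCn≡1; nC1≡n)
open import Data.Nat.ListAction using (sum)
open import Data.Nat.Properties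
open import Data.Nat.Tactic.RingSolver using (solve-∀)
open import Data.Product.Base using (∃; _×_; _,_; proj₁; proj₂)
open import Data.Sum.Base using (_⊎_; inj₁; inj₂)
open import Data.Unit.Base using (tt)
open import Data.Vec.Base using ([]; _∷_; _[_]≔_; lookup; here; there)
open import Data.Vec.Properties
  using (≡-dec; []=⇒lookup; lookup⇒[]=; lookup∘update; lookup∘update′; lookup∘tabulate)
open import Function.Base using (_∘_; id)
open import Level using (0ℓ)
open import Relation.Binary.PropositionalEquality
open import Relation.Nullary using (¬_; Dec; yes; no; contradiction)
open import Relation.Nullary.Decidable using (_×-dec_; _⊎-dec_; ¬?; decidable-stable; dec-true)
open import Relation.Unary using (Pred; _∈_; _∉_; _≐_; ∅)
open import Relation.Unary.Properties using (∅?)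

private
  variable
    n : ℕ
    Ω Ψ : Set
    P Q R : Pred Ω 0ℓ

-- Counting list entries that satisfy a decidable predicate.

filter-map : (P? : Decidable P) (f : Ψ → Ω) →
             ∀ ys → filter P? (map f ys) ≡ map f (filter (P? ∘ f) ys)
filter-map P? f []       = refl
filter-map P? f (y ∷ ys) with P? (f y)
... | yes _ = cong (f y ∷_) (filter-map P? f ys)
... | no  _ = filter-map P? f ys

count : {P : Pred Ω 0ℓ} → Decidable P → List Ω → ℕ
count P? xs = length (filter P? xs)

count-map : (P? : Decidable P) (f : Ψ → Ω) (ys : List Ψ) → count P? (map f ys) ≡ count (P? ∘ f) ys
count-map P? f ys = trans (cong length (filter-map P? f ys)) (length-map f (filter (P? ∘ f) ys))

count-⊎-≤ : (P? : Decidable P) (Q? : Decidable Q) (R? : Decidable R) →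
        (∀ {x} → x ∈ P → x ∈ R) → (∀ {x} → x ∈ Q → x ∈ R) → (∀ {x} → x ∈ P → x ∉ Q) →
        ∀ xs → count P? xs + count Q? xs ≤ count R? xs
count-⊎-≤ P? Q? R? P⊆R Q⊆R P⊥Q []       = z≤n
count-⊎-≤ P? Q? R? P⊆R Q⊆R P⊥Q (x ∷ xs) with count-⊎-≤ P? Q? R? P⊆R Q⊆R P⊥Q xs | P? x | Q? x | R? x
... | _  | yes p | yes q | _     = contradiction q (P⊥Q p)
... | _  | yes p | no _  | no ¬r = contradiction (P⊆R p) ¬r
... | _  | no _  | yes q | no ¬r = contradiction (Q⊆R q) ¬r
... | ih | yes _ | no _  | yes _ = s≤s ih
... | ih | no _  | yes _ | yes _ = ≤-trans (≤-reflexive (+-suc _ _)) (s≤s ih)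
... | ih | no _  | no _  | yes _ = m≤n⇒m≤1+n ih
... | ih | no _  | no _  | no _  = ih

count-≤-⊎ : (P? : Decidable P) (Q? : Decidable Q) (R? : Decidable R) →
        (∀ {x} → x ∈ R → x ∈ P ⊎ x ∈ Q) →
        ∀ xs → count R? xs ≤ count P? xs + count Q? xs
count-≤-⊎ P? Q? R? R⊆P∪Q []       = z≤n
count-≤-⊎ P? Q? R? R⊆P∪Q (x ∷ xs) with count-≤-⊎ P? Q? R? R⊆P∪Q xs | P? x | Q? x | R? x
... | ih | yes _ | yes _ | yes _ = s≤s (≤-trans ih (+-monoʳ-≤ _ (n≤1+n _)))
... | ih | yes _ | no _  | yes _ = s≤s ih
... | ih | no _  | yes _ | yes _ = ≤-trans (s≤s ih) (≤-reflexive (sym (+-suc _ _)))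
... | _  | no ¬p | no ¬q | yes r with R⊆P∪Q r
...   | inj₁ p = contradiction p ¬p
...   | inj₂ q = contradiction q ¬q
count-≤-⊎ P? Q? R? R⊆P∪Q (x ∷ xs) | ih | yes _ | yes _ | no _ =
  ≤-trans ih (+-mono-≤ (n≤1+n _) (n≤1+n _))
count-≤-⊎ P? Q? R? R⊆P∪Q (x ∷ xs) | ih | yes _ | no _  | no _ = m≤n⇒m≤1+n ih
count-≤-⊎ P? Q? R? R⊆P∪Q (x ∷ xs) | ih | no _  | yes _ | no _ = ≤-trans ih (+-monoʳ-≤ _ (n≤1+n _))
count-≤-⊎ P? Q? R? R⊆P∪Q (x ∷ xs) | ih | no _  | no _  | no _ = ih

module _ {X : Set} {P : Pred X 0ℓ} (P? : Decidable P) where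

  *-count-≤-sum : ∀ {a} (f : X → ℕ) → (∀ {x} → x ∈ P → a ≤ f x) →
              ∀ xs → a * count P? xs ≤ sum (map f xs)
  *-count-≤-sum {a = a} f a≤f []       = ≤-reflexive (*-zeroʳ a)
  *-count-≤-sum {a = a} f a≤f (x ∷ xs) with P? x
  ... | yes p = ≤-trans (≤-reflexive (*-suc a _)) (+-mono-≤ (a≤f p) (*-count-≤-sum f a≤f xs))
  ... | no _  = ≤-trans (*-count-≤-sum f a≤f xs) (m≤n+m _ _)

  sum-≤-*-count : ∀ {c} (f : X → ℕ) → (∀ {x} → x ∈ P → f x ≤ c) → (∀ {x} → x ∉ P → f x ≡ 0) →
              ∀ xs → sum (map f xs) ≤ c * count P? xs
  sum-≤-*-count f f≤c f≡0 []       = z≤n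
  sum-≤-*-count {c = c} f f≤c f≡0 (x ∷ xs) with P? x
  ... | yes p = ≤-trans (+-mono-≤ (f≤c p) (sum-≤-*-count f f≤c f≡0 xs)) (≤-reflexive (sym (*-suc c _)))
  ... | no ¬p rewrite f≡0 ¬p = sum-≤-*-count f f≤c f≡0 xs

-- Double counting the edges of a bipartite relation.

module _ {X Y : Set} {R : X → Y → Set} (R? : ∀ x y → Dec (R x y)) where

  deg : List Y → X → ℕ
  deg ys x = count (R? x) ys

  codeg : List X → Y → ℕ
  codeg xs y = count (λ x → R? x y) xs

  sum-codeg-∷ : ∀ x xs ys → sum (map (codeg (x ∷ xs)) ys) ≡ deg ys x + sum (map (codeg xs) ys)
  sum-codeg-∷ x xs []       = refl
  sum-codeg-∷ x xs (y ∷ ys)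
    -- The induction hypothesis is rearranged before the split on `R? x y`: the split then adds one
    -- to both sides or to neither.
    with R? x y
       | trans (cong (codeg xs y +_) (sum-codeg-∷ x xs ys))
               (x∙yz≈y∙xz +-commutativeSemigroup (codeg xs y) (deg ys x) _)
  ... | yes _ | ih = cong suc ih
  ... | no  _ | ih = ih

  sum-deg≡sum-codeg : ∀ xs ys → sum (map (deg ys) xs) ≡ sum (map (codeg xs) ys)
  sum-deg≡sum-codeg []       ys = sym (sum-codeg-[] ys)
    where
    sum-codeg-[] : ∀ ys → sum (map (codeg []) ys) ≡ 0
    sum-codeg-[] []       = refl
    sum-codeg-[] (_ ∷ ys) = sum-codeg-[] ys
  sum-deg≡sum-codeg (x ∷ xs) ys =
    trans (cong (deg ys x +_) (sum-deg≡sum-codeg xs ys)) (sym (sum-codeg-∷ x xs ys))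

  -- Both sides are compared with the number of edges between `xs` and `ys`. Every edge ends in `Q`,
  -- so `codeg` vanishes off `Q` and the bound `c` on `Q` controls the whole sum.
  double-counting : ∀ {P : Pred X 0ℓ} {Q : Pred Y 0ℓ} {a c} →
    (P? : Decidable P) (Q? : Decidable Q) → ∀ xs ys →
    (∀ {x} → x ∈ P → a ≤ deg ys x) →
    (∀ {y} → y ∈ Q → codeg xs y ≤ c) →
    (∀ {x y} → R x y → y ∈ Q) →
    a * count P? xs ≤ c * count Q? ys
  double-counting {Q = Q} {a} {c} P? Q? xs ys a≤deg codeg≤c R⇒Q = begin
    a * count P? xs               ≤⟨ *-count-≤-sum P? (deg ys) a≤deg xs ⟩
    sum (map (deg ys) xs)     ≡⟨ sum-deg≡sum-codeg xs ys ⟩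
    sum (map (codeg xs) ys)   ≤⟨ sum-≤-*-count Q? (codeg xs) codeg≤c codeg≡0 ys ⟩
    c * count Q? ys               ∎
    where
    open ≤-Reasoning
    codeg≡0 : ∀ {y} → y ∉ Q → codeg xs y ≡ 0
    codeg≡0 y∉Q = cong length (filter-none (λ x → R? x _) (universal (λ _ r → y∉Q (R⇒Q r)) xs))

-- Counting the sets of one level in an interval of the Boolean lattice.

-- `allSubsets (suc n)` lists the sets with the first element, then those without it. The two halves
-- have deciders of their own, tied to `𝒫` only by `≐`, so that an induction can land on families of
-- the same shape.
card-∷ : {𝒫 : Family (suc n)} {𝒫ᵢ 𝒫ₒ : Family n}
         (𝒫? : Decidable 𝒫) (𝒫ᵢ? : Decidable 𝒫ᵢ) (𝒫ₒ? : Decidable 𝒫ₒ) →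
         (λ A → inside ∷ A ∈ 𝒫) ≐ 𝒫ᵢ → (λ A → outside ∷ A ∈ 𝒫) ≐ 𝒫ₒ →
         card 𝒫? ≡ card 𝒫ᵢ? + card 𝒫ₒ?
card-∷ {n} 𝒫? 𝒫ᵢ? 𝒫ₒ? ≐ᵢ ≐ₒ = begin
  -- The trailing `[]` comes from unfolding `cartesianProductWith` over the two `sides`.
  count 𝒫? (map (inside ∷_) As ++ (map (outside ∷_) As ++ []))
    ≡⟨ cong (λ Bs → count 𝒫? (map (inside ∷_) As ++ Bs)) (++-identityʳ _) ⟩
  count 𝒫? (map (inside ∷_) As ++ map (outside ∷_) As)
    ≡⟨ cong length (filter-++ 𝒫? (map (inside ∷_) As) _) ⟩
  length (filter 𝒫? (map (inside ∷_) As) ++ filter 𝒫? (map (outside ∷_) As))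
    ≡⟨ length-++ (filter 𝒫? (map (inside ∷_) As)) ⟩
  count 𝒫? (map (inside ∷_) As) + count 𝒫? (map (outside ∷_) As)
    ≡⟨ cong₂ _+_ (count-map 𝒫? (inside ∷_) As) (count-map 𝒫? (outside ∷_) As) ⟩
  count (𝒫? ∘ (inside ∷_)) As + count (𝒫? ∘ (outside ∷_)) As
    ≡⟨ cong₂ _+_ (cong length (filter-≐ (𝒫? ∘ (inside ∷_)) 𝒫ᵢ? ≐ᵢ As))
                 (cong length (filter-≐ (𝒫? ∘ (outside ∷_)) 𝒫ₒ? ≐ₒ As)) ⟩
  card 𝒫ᵢ? + card 𝒫ₒ? ∎
  where
  open ≡-Reasoning
  As = allSubsets n

∅ˢ? : Decidable {A = Subset n} ∅
∅ˢ? = ∅?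

card-∅ : ∀ n → card (∅ˢ? {n}) ≡ 0
card-∅ n = cong length (filter-none ∅? (universal (λ _ ()) (allSubsets n)))

Between : Subset n → Subset n → ℕ → Family n
Between A B m G = A ⊆ˢ G × G ⊆ˢ B × ∣ G ∣ ≡ m

between? : (A B : Subset n) → ∀ m → Decidable (Between A B m)
between? A B m G = (A ⊆? G) ×-dec (G ⊆? B) ×-dec (∣ G ∣ ≟ m)

in⊈out : {A B : Subset n} → ¬ (inside ∷ A ⊆ˢ outside ∷ B)
in⊈out A⊆B with A⊆B here
... | ()

-- A coordinate in both sets or in neither is forced; a coordinate of `B` outside `A` is free and
-- splits the count by Pascal's rule. Writing sizes as sums over `∣ A ∣` avoids truncated
-- subtraction in the induction.
card-between : (A B : Subset n) → A ⊆ˢ B → ∀ {d} → ∣ B ∣ ≡ ∣ A ∣ + d →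
               ∀ s → card (between? A B (∣ A ∣ + s)) ≡ d C s
card-between [] [] A⊆B refl zero    = refl
card-between [] [] A⊆B refl (suc s) = refl
card-between {suc n} (inside ∷ A) (inside ∷ B) A⊆B {d} eq s = begin
  card (between? (inside ∷ A) (inside ∷ B) (suc ∣ A ∣ + s))
    ≡⟨ card-∷ _ (between? A B (∣ A ∣ + s)) (∅ˢ? {n})
         ( (λ (A⊆G , G⊆B , ∣G∣) → drop-∷-⊆ A⊆G , drop-∷-⊆ G⊆B , suc-injective ∣G∣)
         , (λ (A⊆G , G⊆B , ∣G∣) → s⊆s A⊆G , s⊆s G⊆B , cong suc ∣G∣))
         ((λ (A⊆G , _) → in⊈out A⊆G) , λ ()) ⟩
  card (between? A B (∣ A ∣ + s)) + card (∅ˢ? {n})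
    ≡⟨ cong₂ _+_ (card-between A B (drop-∷-⊆ A⊆B) (suc-injective eq) s) (card-∅ n) ⟩
  d C s + 0
    ≡⟨ +-identityʳ _ ⟩
  d C s ∎
  where open ≡-Reasoning
card-between {suc n} (outside ∷ A) (outside ∷ B) A⊆B {d} eq s = begin
  card (between? (outside ∷ A) (outside ∷ B) (∣ A ∣ + s))
    ≡⟨ card-∷ _ (∅ˢ? {n}) (between? A B (∣ A ∣ + s))
         ((λ (_ , G⊆B , _) → in⊈out G⊆B) , λ ())
         ( (λ (A⊆G , G⊆B , ∣G∣) → drop-∷-⊆ A⊆G , drop-∷-⊆ G⊆B , ∣G∣)
         , (λ (A⊆G , G⊆B , ∣G∣) → s⊆s A⊆G , s⊆s G⊆B , ∣G∣)) ⟩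
  card (∅ˢ? {n}) + card (between? A B (∣ A ∣ + s))
    ≡⟨ cong₂ _+_ (card-∅ n) (card-between A B (drop-∷-⊆ A⊆B) eq s) ⟩
  d C s ∎
  where open ≡-Reasoning
card-between {suc n} (outside ∷ A) (inside ∷ B) A⊆B {zero} eq s =
  contradiction (p⊆q⇒∣p∣≤∣q∣ (drop-∷-⊆ A⊆B)) (<⇒≱ (≤-reflexive (trans eq (+-identityʳ _))))
-- On the lowest level the free coordinate cannot be taken, as the rest would be smaller than `A`
-- while containing it.
card-between {suc n} (outside ∷ A) (inside ∷ B) A⊆B {suc d} eq zero = begin
  card (between? (outside ∷ A) (inside ∷ B) (∣ A ∣ + 0))
    ≡⟨ card-∷ _ (∅ˢ? {n}) (between? A B (∣ A ∣ + 0))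
         ( (λ (A⊆G , _ , ∣G∣) → contradiction (p⊆q⇒∣p∣≤∣q∣ (drop-∷-⊆ A⊆G))
             (<⇒≱ (≤-reflexive (trans ∣G∣ (+-identityʳ _)))))
         , λ ())
         ( (λ (A⊆G , G⊆B , ∣G∣) → drop-∷-⊆ A⊆G , drop-∷-⊆ G⊆B , ∣G∣)
         , (λ (A⊆G , G⊆B , ∣G∣) → s⊆s A⊆G , out⊆ G⊆B , ∣G∣)) ⟩
  card (∅ˢ? {n}) + card (between? A B (∣ A ∣ + 0))
    ≡⟨ cong₂ _+_ (card-∅ n)
         (card-between A B (drop-∷-⊆ A⊆B) (suc-injective (trans eq (+-suc _ d))) 0) ⟩
  1 ∎
  where open ≡-Reasoning
card-between {suc n} (outside ∷ A) (inside ∷ B) A⊆B {suc d} eq (suc s) = begin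
  card (between? (outside ∷ A) (inside ∷ B) (∣ A ∣ + suc s))
    ≡⟨ card-∷ _ (between? A B (∣ A ∣ + s)) (between? A B (∣ A ∣ + suc s))
         ( (λ (A⊆G , G⊆B , ∣G∣) →
              drop-∷-⊆ A⊆G , drop-∷-⊆ G⊆B , suc-injective (trans ∣G∣ (+-suc _ s)))
         , (λ (A⊆G , G⊆B , ∣G∣) → out⊆ A⊆G , s⊆s G⊆B , trans (cong suc ∣G∣) (sym (+-suc _ s))))
         ( (λ (A⊆G , G⊆B , ∣G∣) → drop-∷-⊆ A⊆G , drop-∷-⊆ G⊆B , ∣G∣)
         , (λ (A⊆G , G⊆B , ∣G∣) → s⊆s A⊆G , out⊆ G⊆B , ∣G∣)) ⟩
  card (between? A B (∣ A ∣ + s)) + card (between? A B (∣ A ∣ + suc s))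
    ≡⟨ cong₂ _+_ (card-between A B (drop-∷-⊆ A⊆B) eq′ s)
                 (card-between A B (drop-∷-⊆ A⊆B) eq′ (suc s)) ⟩
  d C s + d C suc s
    ≡⟨ nCk+nC[k+1]≡[n+1]C[k+1] d s ⟩
  suc d C suc s ∎
  where
  open ≡-Reasoning
  eq′ : ∣ B ∣ ≡ ∣ A ∣ + d
  eq′ = suc-injective (trans eq (+-suc _ d))
card-between {suc n} (inside ∷ A) (outside ∷ B) A⊆B eq s = ⊥-elim (in⊈out A⊆B)

count-mono : (P? : Decidable P) (Q? : Decidable Q) →
             P ⊆ Q → ∀ xs → count P? xs ≤ count Q? xs
count-mono P? Q? P⊆Q xs =
  m+n≤o⇒m≤o _ (count-⊎-≤ P? ∅? Q? P⊆Q (λ ()) (λ _ ()) xs)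

∈⇒0<card : {𝒫 : Family n} (𝒫? : Decidable 𝒫) {A : Subset n} → A ∈ 𝒫 → 0 < card 𝒫?
∈⇒0<card 𝒫? {A} A∈𝒫 =
  filter-some 𝒫? (Any.map (λ A≡B → subst _ A≡B A∈𝒫) (∈-allSubsets A))

-- Sizes of unions, intersections and traces on a fixed set.

∣p∩q∣+∣p∩∁q∣≡∣p∣ : (p q : Subset n) → ∣ p ∩ q ∣ + ∣ p ∩ ∁ q ∣ ≡ ∣ p ∣
∣p∩q∣+∣p∩∁q∣≡∣p∣ []            []            = refl
∣p∩q∣+∣p∩∁q∣≡∣p∣ (inside  ∷ p) (inside  ∷ q) = cong suc (∣p∩q∣+∣p∩∁q∣≡∣p∣ p q)
∣p∩q∣+∣p∩∁q∣≡∣p∣ (inside  ∷ p) (outside ∷ q) =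
  trans (+-suc _ _) (cong suc (∣p∩q∣+∣p∩∁q∣≡∣p∣ p q))
∣p∩q∣+∣p∩∁q∣≡∣p∣ (outside ∷ p) (inside  ∷ q) = ∣p∩q∣+∣p∩∁q∣≡∣p∣ p q
∣p∩q∣+∣p∩∁q∣≡∣p∣ (outside ∷ p) (outside ∷ q) = ∣p∩q∣+∣p∩∁q∣≡∣p∣ p q

∣p∪q∣+∣p∩q∣≡∣p∣+∣q∣ : (p q : Subset n) → ∣ p ∪ q ∣ + ∣ p ∩ q ∣ ≡ ∣ p ∣ + ∣ q ∣
∣p∪q∣+∣p∩q∣≡∣p∣+∣q∣ []            []            = refl
∣p∪q∣+∣p∩q∣≡∣p∣+∣q∣ (inside  ∷ p) (inside  ∷ q) =
  cong suc (trans (+-suc _ _) (trans (cong suc (∣p∪q∣+∣p∩q∣≡∣p∣+∣q∣ p q)) (sym (+-suc _ _))))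
∣p∪q∣+∣p∩q∣≡∣p∣+∣q∣ (inside  ∷ p) (outside ∷ q) = cong suc (∣p∪q∣+∣p∩q∣≡∣p∣+∣q∣ p q)
∣p∪q∣+∣p∩q∣≡∣p∣+∣q∣ (outside ∷ p) (inside  ∷ q) =
  trans (cong suc (∣p∪q∣+∣p∩q∣≡∣p∣+∣q∣ p q)) (sym (+-suc _ _))
∣p∪q∣+∣p∩q∣≡∣p∣+∣q∣ (outside ∷ p) (outside ∷ q) = ∣p∪q∣+∣p∩q∣≡∣p∣+∣q∣ p q

F∩∁Y⊆G⇒F⊆G∪Y : {F G : Subset n} (Y : Subset n) → F ∩ ∁ Y ⊆ˢ G → F ⊆ˢ G ∪ Y
F∩∁Y⊆G⇒F⊆G∪Y Y F∩∁Y⊆G {x} x∈F with x ∈? Y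
... | yes x∈Y = x∈p∪q⁺ (inj₂ x∈Y)
... | no  x∉Y = x∈p∪q⁺ (inj₁ (F∩∁Y⊆G (x∈p∩q⁺ (x∈F , x∉p⇒x∈∁p x∉Y))))

F⊆G∪Y⇒F∩∁Y⊆G : {F G : Subset n} (Y : Subset n) → F ⊆ˢ G ∪ Y → F ∩ ∁ Y ⊆ˢ G
F⊆G∪Y⇒F∩∁Y⊆G {F = F} {G} Y F⊆G∪Y x∈F∩∁Y with x∈p∩q⁻ F (∁ Y) x∈F∩∁Y
... | x∈F , x∈∁Y with x∈p∪q⁻ G Y (F⊆G∪Y x∈F)
...   | inj₁ x∈G = x∈G
...   | inj₂ x∈Y = contradiction x∈Y (x∈∁p⇒x∉p x∈∁Y)

-- Off `Y` the two sets coincide, so all `j` deleted elements lie in `Y`. Hence `G` alone fixes the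
-- size of the trace of `F`.
∣F∩Y∣≡∣G∩Y∣+j : ∀ {F G} (Y : Subset n) {j} → G ⊆ˢ F → F ⊆ˢ G ∪ Y → ∣ F ∣ ≡ ∣ G ∣ + j →
                ∣ F ∩ Y ∣ ≡ ∣ G ∩ Y ∣ + j
∣F∩Y∣≡∣G∩Y∣+j {F = F} {G} Y {j} G⊆F F⊆G∪Y ∣F∣ = +-cancelʳ-≡ ∣ G ∩ ∁ Y ∣ _ _ (begin
  ∣ F ∩ Y ∣ + ∣ G ∩ ∁ Y ∣       ≡⟨ cong (λ A → ∣ F ∩ Y ∣ + ∣ A ∣) F∩∁Y≡G∩∁Y ⟨
  ∣ F ∩ Y ∣ + ∣ F ∩ ∁ Y ∣       ≡⟨ ∣p∩q∣+∣p∩∁q∣≡∣p∣ F Y ⟩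
  ∣ F ∣                         ≡⟨ ∣F∣ ⟩
  ∣ G ∣ + j                     ≡⟨ cong (_+ j) (∣p∩q∣+∣p∩∁q∣≡∣p∣ G Y) ⟨
  ∣ G ∩ Y ∣ + ∣ G ∩ ∁ Y ∣ + j   ≡⟨ +-assoc ∣ G ∩ Y ∣ _ j ⟩
  ∣ G ∩ Y ∣ + (∣ G ∩ ∁ Y ∣ + j) ≡⟨ cong (∣ G ∩ Y ∣ +_) (+-comm _ j) ⟩
  ∣ G ∩ Y ∣ + (j + ∣ G ∩ ∁ Y ∣) ≡⟨ +-assoc ∣ G ∩ Y ∣ j _ ⟨
  ∣ G ∩ Y ∣ + j + ∣ G ∩ ∁ Y ∣   ∎)
  where
  open ≡-Reasoning
  F∩∁Y≡G∩∁Y : F ∩ ∁ Y ≡ G ∩ ∁ Y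
  F∩∁Y≡G∩∁Y = ⊆-antisym
    (λ x∈ → x∈p∩q⁺ (F⊆G∪Y⇒F∩∁Y⊆G {F = F} {G} Y F⊆G∪Y x∈ , p∩q⊆q F (∁ Y) x∈))
    (λ x∈ → x∈p∩q⁺ (G⊆F (p∩q⊆p G (∁ Y) x∈) , p∩q⊆q G (∁ Y) x∈))

-- Inequalities between binomial coefficients.

C-monoˡ-suc : ∀ n k → n C k ≤ suc n C k
C-monoˡ-suc n zero    = ≤-refl
C-monoˡ-suc n (suc k) = ≤-trans (m≤n+m _ (n C k)) (≤-reflexive (nCk+nC[k+1]≡[n+1]C[k+1] n k))

C-monoˡ-≤ : ∀ {m n} k → m ≤ n → m C k ≤ n C k
C-monoˡ-≤ {m} k m≤n = go (≤⇒≤′ m≤n)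
  where
  go : ∀ {n} → m ≤′ n → m C k ≤ n C k
  go (≤′-reflexive refl) = ≤-refl
  go (≤′-step m≤′n)      = ≤-trans (go m≤′n) (C-monoˡ-suc _ k)

-- Choosing `k` of `n` pairs and then one point from each gives distinct `k`-sets of `n + n` points.
-- The induction expands by Pascal's rule: of the two copies of `(n + n) C k`, one is raised to
-- `suc (n + n) C k` and the other merges with `(n + n) C suc k`.
2^k*nCk≤[n+n]Ck : ∀ n k → 2 ^ k * (n C k) ≤ (n + n) C k
2^k*nCk≤[n+n]Ck zero    zero    = ≤-refl
2^k*nCk≤[n+n]Ck zero    (suc k) = ≤-reflexive (*-zeroʳ (2 ^ suc k))
2^k*nCk≤[n+n]Ck (suc n) zero    = ≤-refl
2^k*nCk≤[n+n]Ck (suc n) (suc k) = begin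
  2 ^ suc k * (suc n C suc k)
    ≡⟨ cong (2 ^ suc k *_) (nCk+nC[k+1]≡[n+1]C[k+1] n k) ⟨
  2 ^ suc k * (n C k + n C suc k)
    ≡⟨ distrib (2 ^ k) (n C k) (n C suc k) ⟩
  2 ^ k * (n C k) + (2 ^ k * (n C k) + 2 ^ suc k * (n C suc k))
    ≤⟨ +-mono-≤ (2^k*nCk≤[n+n]Ck n k) (+-mono-≤ (2^k*nCk≤[n+n]Ck n k) (2^k*nCk≤[n+n]Ck n (suc k))) ⟩
  (n + n) C k + ((n + n) C k + (n + n) C suc k)
    ≤⟨ +-mono-≤ (C-monoˡ-suc (n + n) k) (≤-reflexive (nCk+nC[k+1]≡[n+1]C[k+1] (n + n) k)) ⟩
  suc (n + n) C k + suc (n + n) C suc k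
    ≡⟨ nCk+nC[k+1]≡[n+1]C[k+1] (suc (n + n)) k ⟩
  suc (suc (n + n)) C suc k
    ≡⟨ cong (λ m → suc m C suc k) (+-suc n n) ⟨
  (suc n + suc n) C suc k ∎
  where
  open ≤-Reasoning
  distrib : ∀ a b c → 2 * a * (b + c) ≡ a * b + (a * b + 2 * a * c)
  distrib = solve-∀

n<2^n : ∀ n → n < 2 ^ n
n<2^n zero    = s≤s z≤n
n<2^n (suc n) = +-mono-≤ (≤-trans (s≤s z≤n) (n<2^n n)) (≤-trans (n<2^n n) (m≤m+n _ 0))

[1+n]Cn≡1+n : ∀ n → suc n C n ≡ suc n
[1+n]Cn≡1+n n = begin
  suc n C n             ≡⟨ nCk≡nC[n∸k] (n≤1+n n) ⟩
  suc n C (suc n ∸ n)   ≡⟨ cong (suc n C_) (m+n∸n≡m 1 n) ⟩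
  suc n C 1             ≡⟨ nC1≡n (suc n) ⟩
  suc n                 ∎
  where open ≡-Reasoning

-- Shadows formed by deletions inside a fixed set.

-- The clause `F ⊆ˢ G ∪ Y` confines the `j` deleted elements to `Y`.
LocalShadow : Subset n → ℕ → Family n → Family n
LocalShadow Y j 𝒫 G = ∃ λ F → F ∈ 𝒫 × ∣ F ∣ ≡ ∣ G ∣ + j × G ⊆ˢ F × F ⊆ˢ G ∪ Y

localShadow? : ∀ Y j {𝒫 : Family n} → Decidable 𝒫 → Decidable (LocalShadow Y j 𝒫)
localShadow? Y j 𝒫? G = anySubset? λ F →
  𝒫? F ×-dec (∣ F ∣ ≟ ∣ G ∣ + j) ×-dec (G ⊆? F) ×-dec (F ⊆? (G ∪ Y))

-- Double counting of the pairs `G ⊆ F`. A member has at least `a` elements of `Y` to delete from. A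
-- shadow set keeps at least `a ∸ j` elements of `Y`, so at most `c + j` elements of `Y` lie outside
-- it, and `j` of these are added back.
card-localShadow : ∀ (Y : Subset n) {a c j} {𝒫 : Family n} (𝒫? : Decidable 𝒫) →
  j ≤ a → ∣ Y ∣ ≤ a + c → (∀ {F} → F ∈ 𝒫 → a ≤ ∣ F ∩ Y ∣) →
  (a C j) * card 𝒫? ≤ ((c + j) C j) * card (localShadow? Y j 𝒫?)
card-localShadow {n} Y {a} {c} {j} {𝒫} 𝒫? j≤a ∣Y∣≤a+c a≤∣F∩Y∣ =
  double-counting Edge? 𝒫? (localShadow? Y j 𝒫?) As As aCj≤deg codeg≤[c+j]Cj (λ {F} e → F , e)
  where
  open ≤-Reasoning
  As = allSubsets n

  Edge : Subset n → Subset n → Set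
  Edge F G = F ∈ 𝒫 × ∣ F ∣ ≡ ∣ G ∣ + j × G ⊆ˢ F × F ⊆ˢ G ∪ Y

  Edge? : ∀ F G → Dec (Edge F G)
  Edge? F G = 𝒫? F ×-dec (∣ F ∣ ≟ ∣ G ∣ + j) ×-dec (G ⊆? F) ×-dec (F ⊆? (G ∪ Y))

  aCj≤deg : ∀ {F} → F ∈ 𝒫 → a C j ≤ deg Edge? As F
  aCj≤deg {F} F∈𝒫 = begin
    a C j                                          ≤⟨ C-monoˡ-≤ j (a≤∣F∩Y∣ F∈𝒫) ⟩
    -- Deleting `j` of the `d` elements of `F ∩ Y` is counted as keeping `d ∸ j` of them above
    -- `F ∩ ∁ Y`.
    d C j                                          ≡⟨ nCk≡nC[n∸k] j≤d ⟩
    d C (d ∸ j)                                    ≡⟨ card-between (F ∩ ∁ Y) F (p∩q⊆p F (∁ Y)) ∣F∣ (d ∸ j) ⟨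
    card (between? (F ∩ ∁ Y) F (∣ F ∩ ∁ Y ∣ + (d ∸ j))) ≤⟨ count-mono _ (Edge? F) between⇒Edge As ⟩
    deg Edge? As F                                    ∎
    where
    d = ∣ F ∩ Y ∣
    j≤d : j ≤ d
    j≤d = ≤-trans j≤a (a≤∣F∩Y∣ F∈𝒫)

    ∣F∣ : ∣ F ∣ ≡ ∣ F ∩ ∁ Y ∣ + d
    ∣F∣ = trans (sym (∣p∩q∣+∣p∩∁q∣≡∣p∣ F Y)) (+-comm d _)

    between⇒Edge : ∀ {G} → Between (F ∩ ∁ Y) F (∣ F ∩ ∁ Y ∣ + (d ∸ j)) G → Edge F G
    between⇒Edge (F∩∁Y⊆G , G⊆F , ∣G∣) =
      F∈𝒫 ,
      trans ∣F∣ (trans (cong (∣ F ∩ ∁ Y ∣ +_) (sym (m∸n+n≡m j≤d)))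
        (trans (sym (+-assoc ∣ F ∩ ∁ Y ∣ (d ∸ j) j)) (cong (_+ j) (sym ∣G∣)))) ,
      G⊆F , F∩∁Y⊆G⇒F⊆G∪Y Y F∩∁Y⊆G

  codeg≤[c+j]Cj : ∀ {G} → G ∈ LocalShadow Y j 𝒫 → codeg Edge? As G ≤ (c + j) C j
  codeg≤[c+j]Cj {G} (F , F∈𝒫 , ∣F∣ , G⊆F , F⊆G∪Y) = begin
    codeg Edge? As G
      ≤⟨ count-mono (λ F → Edge? F G) (between? G (G ∪ Y) (∣ G ∣ + j))
           (λ (_ , ∣F∣ , G⊆F , F⊆G∪Y) → G⊆F , F⊆G∪Y , ∣F∣) As ⟩
    card (between? G (G ∪ Y) (∣ G ∣ + j))
      ≡⟨ card-between G (G ∪ Y) (p⊆p∪q Y) (sym (m+[n∸m]≡n (∣p∣≤∣p∪q∣ G Y))) j ⟩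
    d C j
      ≤⟨ C-monoˡ-≤ j d≤c+j ⟩
    (c + j) C j ∎
    where
    -- This is the number of elements of `Y` outside `G`.
    d = ∣ G ∪ Y ∣ ∸ ∣ G ∣

    d+∣G∩Y∣≡∣Y∣ : d + ∣ G ∩ Y ∣ ≡ ∣ Y ∣
    d+∣G∩Y∣≡∣Y∣ = +-cancelˡ-≡ ∣ G ∣ _ _ (trans (sym (+-assoc ∣ G ∣ d _))
      (trans (cong (_+ ∣ G ∩ Y ∣) (m+[n∸m]≡n (∣p∣≤∣p∪q∣ G Y))) (∣p∪q∣+∣p∩q∣≡∣p∣+∣q∣ G Y)))

    d≤c+j : d ≤ c + j
    d≤c+j = +-cancelʳ-≤ a _ _ (begin
      d + a                 ≤⟨ +-monoʳ-≤ d (a≤∣F∩Y∣ F∈𝒫) ⟩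
      d + ∣ F ∩ Y ∣         ≡⟨ cong (d +_) (∣F∩Y∣≡∣G∩Y∣+j Y G⊆F F⊆G∪Y ∣F∣) ⟩
      d + (∣ G ∩ Y ∣ + j)   ≡⟨ +-assoc d _ j ⟨
      d + ∣ G ∩ Y ∣ + j     ≡⟨ cong (_+ j) d+∣G∩Y∣≡∣Y∣ ⟩
      ∣ Y ∣ + j             ≤⟨ +-monoˡ-≤ j ∣Y∣≤a+c ⟩
      a + c + j             ≡⟨ +-assoc a c j ⟩
      a + (c + j)           ≡⟨ +-comm a _ ⟩
      c + j + a             ∎)

-- The strict shadow bound for families obeying the dichotomy.

module _
  {t j : ℕ} (j<t : j < t) {T X : Subset n} (T⊆X : T ⊆ˢ X)
  (∣T∣≡t : ∣ T ∣ ≡ t) (∣X∣≤2t+1 : ∣ X ∣ ≤ t + t + 1)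
  {ℱ : Family n} (ℱ? : Decidable ℱ) (dichotomy : ∀ {F} → F ∈ ℱ → T ⊆ˢ F ⊎ t + t ≤ ∣ F ∩ X ∣)
  where

  private
    j≤t = <⇒≤ j<t

    -- The split is by the trace on `X` alone: a member containing `T` with a large trace goes to
    -- `ℒ`. Members of `𝒮` all contain `T` by `dichotomy`.
    𝒮 ℒ : Family n
    𝒮 F = F ∈ ℱ × ¬ (t + t ≤ ∣ F ∩ X ∣)
    ℒ F = F ∈ ℱ × t + t ≤ ∣ F ∩ X ∣

    𝒮? : Decidable 𝒮
    𝒮? F = ℱ? F ×-dec ¬? (t + t ≤? ∣ F ∩ X ∣)

    ℒ? : Decidable ℒ
    ℒ? F = ℱ? F ×-dec (t + t ≤? ∣ F ∩ X ∣)

    ∂𝒮? = localShadow? T j 𝒮?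
    ∂ℒ? = localShadow? X j ℒ?

    -- Here `c = 0`: a member contains all of `T`, so it is recovered from a shadow set `G` as
    -- `G ∪ T`.
    card-∂𝒮 : (t C j) * card 𝒮? ≤ card ∂𝒮?
    card-∂𝒮 = begin
      (t C j) * card 𝒮?
        ≤⟨ card-localShadow T {c = 0} 𝒮? j≤t
             (≤-reflexive (trans ∣T∣≡t (sym (+-identityʳ t)))) t≤∣F∩T∣ ⟩
      (j C j) * card ∂𝒮?        ≡⟨ cong (_* card ∂𝒮?) (nCn≡1 j) ⟩
      1 * card ∂𝒮?              ≡⟨ *-identityˡ _ ⟩
      card ∂𝒮?                  ∎
      where
      open ≤-Reasoning
      t≤∣F∩T∣ : ∀ {F} → F ∈ 𝒮 → t ≤ ∣ F ∩ T ∣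
      t≤∣F∩T∣ (F∈ℱ , ¬large) with dichotomy F∈ℱ
      ... | inj₁ T⊆F   = ≤-trans (≤-reflexive (sym ∣T∣≡t))
        (p⊆q⇒∣p∣≤∣q∣ λ x∈T → x∈p∩q⁺ (T⊆F x∈T , x∈T))
      ... | inj₂ large = contradiction large ¬large

    -- Here `a = t + t` and `c = 1`: a member misses at most one element of `X`, so a shadow set has
    -- at most `suc j` extensions. This factor is absorbed by `suc j ≤ 2 ^ j` and then cancelled.
    card-∂ℒ : (t C j) * card ℒ? ≤ card ∂ℒ?
    card-∂ℒ = *-cancelˡ-≤ (suc j) (begin
      suc j * ((t C j) * card ℒ?)     ≡⟨ *-assoc (suc j) (t C j) _ ⟨
      suc j * (t C j) * card ℒ?       ≤⟨ *-monoˡ-≤ _ (*-monoˡ-≤ (t C j) (n<2^n j)) ⟩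
      2 ^ j * (t C j) * card ℒ?       ≤⟨ *-monoˡ-≤ _ (2^k*nCk≤[n+n]Ck t j) ⟩
      ((t + t) C j) * card ℒ?
        ≤⟨ card-localShadow X {c = 1} ℒ? (≤-trans j≤t (m≤m+n t t)) ∣X∣≤2t+1 proj₂ ⟩
      (suc j C j) * card ∂ℒ?          ≡⟨ cong (_* card ∂ℒ?) ([1+n]Cn≡1+n j) ⟩
      suc j * card ∂ℒ?                ∎)
      where open ≤-Reasoning

  -- `𝒬` stands for the shadow. The conditions on `G₀` say that adding back `j` elements of `T`
  -- would overfill `T`, and that adding back `j` elements of `X` leaves a trace below `t + t`. So
  -- `G₀` is in neither local shadow and gives the strict inequality.
  card-shadow-> : {𝒬 : Family n} (𝒬? : Decidable 𝒬) →
    (∀ {F G} → F ∈ ℱ → ∣ F ∣ ≡ ∣ G ∣ + j → G ⊆ˢ F → G ∈ 𝒬) →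
    ∀ {G₀} → G₀ ∈ 𝒬 → t < ∣ G₀ ∩ T ∣ + j → ∣ G₀ ∩ X ∣ + j < t + t →
    (t C j) * card ℱ? < card 𝒬?
  card-shadow-> {𝒬} 𝒬? ∂⊆𝒬 {G₀} G₀∈𝒬 t<∣G₀∩T∣+j ∣G₀∩X∣+j<2t = begin-strict
    (t C j) * card ℱ?                         ≤⟨ *-monoʳ-≤ (t C j) (count-≤-⊎ 𝒮? ℒ? ℱ? split As) ⟩
    (t C j) * (card 𝒮? + card ℒ?)             ≡⟨ *-distribˡ-+ (t C j) _ _ ⟩
    (t C j) * card 𝒮? + (t C j) * card ℒ?     ≤⟨ +-mono-≤ card-∂𝒮 card-∂ℒ ⟩
    card ∂𝒮? + card ∂ℒ?                       ≤⟨ count-⊎-≤ ∂𝒮? ∂ℒ? ∂? inj₁ inj₂ ∂𝒮⊥∂ℒ As ⟩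
    card ∂?                                   <⟨ m<m+n _ (∈⇒0<card ≡G₀? refl) ⟩
    card ∂? + card ≡G₀?
      ≤⟨ count-⊎-≤ ∂? ≡G₀? 𝒬? ∂⊆ (λ { refl → G₀∈𝒬 }) (λ { G∈∂ refl → G₀∉∂ G∈∂ }) As ⟩
    card 𝒬?                                   ∎
    where
    open ≤-Reasoning
    As = allSubsets n

    ∂ : Family n
    ∂ G = G ∈ LocalShadow T j 𝒮 ⊎ G ∈ LocalShadow X j ℒ

    ∂? : Decidable ∂
    ∂? G = ∂𝒮? G ⊎-dec ∂ℒ? G

    ≡G₀? : Decidable (_≡ G₀)
    ≡G₀? G = ≡-dec _≟ᵇ_ G G₀

    split : ∀ {F} → F ∈ ℱ → F ∈ 𝒮 ⊎ F ∈ ℒ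
    split {F} F∈ℱ with t + t ≤? ∣ F ∩ X ∣
    ... | yes large = inj₂ (F∈ℱ , large)
    ... | no ¬large = inj₁ (F∈ℱ , ¬large)

    ∂⊆ : ∂ ⊆ 𝒬
    ∂⊆ (inj₁ (F , (F∈ℱ , _) , ∣F∣ , G⊆F , _)) = ∂⊆𝒬 F∈ℱ ∣F∣ G⊆F
    ∂⊆ (inj₂ (F , (F∈ℱ , _) , ∣F∣ , G⊆F , _)) = ∂⊆𝒬 F∈ℱ ∣F∣ G⊆F

    -- As `T ⊆ X`, both deletions happen inside `X`. Both preimages of `G` would then have trace
    -- size `∣ G ∩ X ∣ + j`, small for one and large for the other.
    ∂𝒮⊥∂ℒ : ∀ {G} → G ∈ LocalShadow T j 𝒮 → G ∉ LocalShadow X j ℒ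
    ∂𝒮⊥∂ℒ {G} (F , (_ , ¬large) , ∣F∣ , G⊆F , F⊆G∪T) (F′ , (_ , large) , ∣F′∣ , G⊆F′ , F′⊆G∪X) =
      ¬large (begin
        t + t           ≤⟨ large ⟩
        ∣ F′ ∩ X ∣      ≡⟨ ∣F∩Y∣≡∣G∩Y∣+j X G⊆F′ F′⊆G∪X ∣F′∣ ⟩
        ∣ G ∩ X ∣ + j   ≡⟨ ∣F∩Y∣≡∣G∩Y∣+j X G⊆F F⊆G∪X ∣F∣ ⟨
        ∣ F ∩ X ∣       ∎)
      where
      F⊆G∪X : F ⊆ˢ G ∪ X
      F⊆G∪X x∈F with x∈p∪q⁻ G T (F⊆G∪T x∈F)
      ... | inj₁ x∈G = x∈p∪q⁺ (inj₁ x∈G)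
      ... | inj₂ x∈T = x∈p∪q⁺ (inj₂ (T⊆X x∈T))

    G₀∉∂ : G₀ ∉ ∂
    G₀∉∂ (inj₁ (F , _ , ∣F∣ , G⊆F , F⊆G∪T)) = <⇒≱ t<∣G₀∩T∣+j (begin
      ∣ G₀ ∩ T ∣ + j  ≡⟨ ∣F∩Y∣≡∣G∩Y∣+j T G⊆F F⊆G∪T ∣F∣ ⟨
      ∣ F ∩ T ∣       ≤⟨ ∣p∩q∣≤∣q∣ F T ⟩
      ∣ T ∣           ≡⟨ ∣T∣≡t ⟩
      t               ∎)
    G₀∉∂ (inj₂ (F , (_ , large) , ∣F∣ , G⊆F , F⊆G∪X)) = <⇒≱ ∣G₀∩X∣+j<2t (begin
      t + t           ≤⟨ large ⟩
      ∣ F ∩ X ∣       ≡⟨ ∣F∩Y∣≡∣G∩Y∣+j X G⊆F F⊆G∪X ∣F∣ ⟩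
      ∣ G₀ ∩ X ∣ + j  ∎)

-- The shifting order and single exchanges.

filter-∈?-tabulate-suc : ∀ s (A : Subset n) →
                         filter (_∈? (s ∷ A)) (tabulate suc) ≡ map suc (elements A)
filter-∈?-tabulate-suc {n} s A = begin
  filter (_∈? (s ∷ A)) (tabulate suc)           ≡⟨ cong (filter (_∈? (s ∷ A))) (map-tabulate id suc) ⟨
  filter (_∈? (s ∷ A)) (map suc (allFin n))     ≡⟨ filter-map (_∈? (s ∷ A)) suc (allFin n) ⟩
  map suc (filter ((_∈? (s ∷ A)) ∘ suc) (allFin n))
    ≡⟨ cong (map suc) (filter-≐ _ (_∈? A) (drop-there , there) (allFin n)) ⟩
  map suc (elements A)                          ∎
  where open ≡-Reasoning

elements-inside : (A : Subset n) → elements (inside ∷ A) ≡ zero ∷ map suc (elements A)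
elements-inside A = cong (zero ∷_) (filter-∈?-tabulate-suc inside A)

elements-outside : (A : Subset n) → elements (outside ∷ A) ≡ map suc (elements A)
elements-outside A = filter-∈?-tabulate-suc outside A

map-suc⁺ : ∀ {is js : List (Fin n)} → Pointwise _≤ᶠ_ is js → Pointwise _≤ᶠ_ (map suc is) (map suc js)
map-suc⁺ []       = []
map-suc⁺ (p ∷ ps) = s≤s p ∷ map-suc⁺ ps

≤ᶠ-refl : ∀ {is : List (Fin n)} → Pointwise _≤ᶠ_ is is
≤ᶠ-refl = Pointwise.refl ≤-refl

-- With a new least element in front and `e` removed, each element below `e` moves one place later
-- and is compared with its successor in `F`; those above `e` keep their places.
remove-≤ : ∀ {e} (F : Subset n) → e ∈ˢ F →
           Pointwise _≤ᶠ_ (zero ∷ map suc (elements (F [ e ]≔ outside))) (map suc (elements F))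
remove-≤ (inside ∷ F) here =
  subst₂ (λ is js → Pointwise _≤ᶠ_ (zero ∷ map suc is) (map suc js))
    (sym (elements-outside F)) (sym (elements-inside F)) (z≤n ∷ ≤ᶠ-refl)
remove-≤ {e = suc e} (inside ∷ F) (there e∈F) =
  subst₂ (λ is js → Pointwise _≤ᶠ_ (zero ∷ map suc is) (map suc js))
    (sym (elements-inside (F [ e ]≔ outside))) (sym (elements-inside F))
    (z≤n ∷ map-suc⁺ (remove-≤ F e∈F))
remove-≤ {e = suc e} (outside ∷ F) (there e∈F) =
  subst₂ (λ is js → Pointwise _≤ᶠ_ (zero ∷ map suc is) (map suc js))
    (sym (elements-outside (F [ e ]≔ outside))) (sym (elements-outside F))
    (lower-head (map-suc⁺ (remove-≤ F e∈F)))
  where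
  lower-head : ∀ {m} {i : Fin (suc m)} {is js : List (Fin (suc m))} →
               Pointwise _≤ᶠ_ (i ∷ is) js → Pointwise _≤ᶠ_ (zero ∷ is) js
  lower-head (_ ∷ ps) = z≤n ∷ ps

exchange : Subset n → Fin n → Fin n → Subset n
exchange F e x = F [ e ]≔ outside [ x ]≔ inside

-- The recursion strips the common part below `x`. Once `x` is the first coordinate, `remove-≤`
-- applies.
exchange-≺ : ∀ {e x} (F : Subset n) → e ∈ˢ F → x ∉ˢ F → x <ᶠ e → exchange F e x ≺ F
exchange-≺ {e = suc e} {zero}  (inside  ∷ F) e∈F x∉F x<e = contradiction here x∉F
exchange-≺ {e = suc e} {zero}  (outside ∷ F) e∈F x∉F x<e =
  subst₂ (Pointwise _≤ᶠ_) (sym (elements-inside (F [ e ]≔ outside))) (sym (elements-outside F))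
    (remove-≤ F (drop-there e∈F))
exchange-≺ {e = suc e} {suc x} (inside  ∷ F) e∈F x∉F (s≤s x<e) =
  subst₂ (Pointwise _≤ᶠ_) (sym (elements-inside (exchange F e x))) (sym (elements-inside F))
    (z≤n ∷ map-suc⁺ (exchange-≺ F (drop-there e∈F) (x∉F ∘ there) x<e))
exchange-≺ {e = suc e} {suc x} (outside ∷ F) e∈F x∉F (s≤s x<e) =
  subst₂ (Pointwise _≤ᶠ_) (sym (elements-outside (exchange F e x))) (sym (elements-outside F))
    (map-suc⁺ (exchange-≺ F (drop-there e∈F) (x∉F ∘ there) x<e))

module _ {F : Subset n} {e x : Fin n} where

  x∈exchange : x ∈ˢ exchange F e x
  x∈exchange = lookup⇒[]= x _ (lookup∘update x (F [ e ]≔ outside) inside)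

  ∈-exchange⁺ : ∀ {z} → z ∈ˢ F → z ≢ e → z ∈ˢ exchange F e x
  ∈-exchange⁺ {z} z∈F z≢e with z Fin.≟ x
  ... | yes refl = x∈exchange
  ... | no  z≢x  = lookup⇒[]= z _ (begin
    lookup (exchange F e x) z   ≡⟨ lookup∘update′ z≢x (F [ e ]≔ outside) inside ⟩
    lookup (F [ e ]≔ outside) z ≡⟨ lookup∘update′ z≢e F outside ⟩
    lookup F z                  ≡⟨ []=⇒lookup z∈F ⟩
    inside                      ∎)
    where open ≡-Reasoning

  ∈-exchange⁻ : ∀ {z} → z ∈ˢ exchange F e x → z ≢ x → z ∈ˢ F × z ≢ e
  ∈-exchange⁻ {z} z∈ z≢x = lookup⇒[]= z _ (trans (sym (lookup∘update′ z≢e F outside)) z∈′) , z≢e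
    where
    z∈′ : lookup (F [ e ]≔ outside) z ≡ inside
    z∈′ = trans (sym (lookup∘update′ z≢x (F [ e ]≔ outside) inside)) ([]=⇒lookup z∈)
    z≢e : z ≢ e
    z≢e refl with () ← trans (sym (lookup∘update e F outside)) z∈′

-- Initial segments and missing elements.

∈-[1…]⁺ : ∀ m {i : Fin n} → toℕ i < m → i ∈ˢ [1… m ]
∈-[1…]⁺ m {i} i<m = lookup⇒[]= i _ (trans (lookup∘tabulate _ i) (dec-true (toℕ i <? m) i<m))

∈-[1…]⁻ : ∀ m {i : Fin n} → i ∈ˢ [1… m ] → toℕ i < m
∈-[1…]⁻ m {i} i∈ =
  <ᵇ⇒< (toℕ i) m (subst Bool.T (trans (sym ([]=⇒lookup i∈)) (lookup∘tabulate _ i)) tt)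

[1…]-mono : ∀ {l m} → l ≤ m → [1… l ] ⊆ˢ [1…_] {n} m
[1…]-mono {l = l} {m} l≤m i∈ = ∈-[1…]⁺ m (<-≤-trans (∈-[1…]⁻ l i∈) l≤m)

∣[1…m]∣≤m : ∀ n m → ∣ [1…_] {n} m ∣ ≤ m
∣[1…m]∣≤m zero    m       = z≤n
∣[1…m]∣≤m (suc n) zero    = ∣[1…m]∣≤m n zero
∣[1…m]∣≤m (suc n) (suc m) = s≤s (∣[1…m]∣≤m n m)

∣[1…m]∣≡m : ∀ {n m} → m ≤ n → ∣ [1…_] {n} m ∣ ≡ m
∣[1…m]∣≡m {zero}  z≤n       = refl
∣[1…m]∣≡m {suc n} z≤n       = ∣[1…m]∣≡m {n} z≤n
∣[1…m]∣≡m {suc n} (s≤s m≤n) = cong suc (∣[1…m]∣≡m m≤n)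

⊈⇒∃ : (p q : Subset n) → ¬ (p ⊆ˢ q) → ∃ λ x → x ∈ˢ p × x ∉ˢ q
⊈⇒∃ p q p⊈q with Fin.any? (λ x → (x ∈? p) ×-dec ¬? (x ∈? q))
... | yes x∈p∖q = x∈p∖q
... | no ¬∃     =
  contradiction (λ {x} x∈p → decidable-stable (x ∈? q) λ x∉q → ¬∃ (x , x∈p , x∉q)) p⊈q

x∉p-x : (p : Subset n) (x : Fin n) → x ∉ˢ p - x
x∉p-x (_ ∷ p) zero    ()
x∉p-x (_ ∷ p) (suc x) (there x∈) = x∉p-x p x x∈

∣p∣≤1+∣p-x∣ : (p : Subset n) (x : Fin n) → ∣ p ∣ ≤ suc ∣ p - x ∣
∣p∣≤1+∣p-x∣ p x = begin
  ∣ p ∣                                           ≤⟨ p⊆q⇒∣p∣≤∣q∣ p⊆ ⟩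
  ∣ (p - x) ∪ ⁅ x ⁆ ∣                             ≤⟨ m≤m+n _ _ ⟩
  ∣ (p - x) ∪ ⁅ x ⁆ ∣ + ∣ (p - x) ∩ ⁅ x ⁆ ∣       ≡⟨ ∣p∪q∣+∣p∩q∣≡∣p∣+∣q∣ (p - x) ⁅ x ⁆ ⟩
  ∣ p - x ∣ + ∣ ⁅ x ⁆ ∣                           ≡⟨ cong (∣ p - x ∣ +_) (∣⁅x⁆∣≡1 x) ⟩
  ∣ p - x ∣ + 1                                   ≡⟨ +-comm _ 1 ⟩
  suc ∣ p - x ∣                                   ∎
  where
  open ≤-Reasoning
  p⊆ : p ⊆ˢ (p - x) ∪ ⁅ x ⁆
  p⊆ {z} z∈p with z Fin.≟ x
  ... | yes refl = x∈p∪q⁺ (inj₂ (x∈⁅x⁆ z))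
  ... | no  z≢x  = x∈p∪q⁺ (inj₁ (x∈p∧x≢y⇒x∈p-y z∈p z≢x))

missing-two : {p q : Subset n} → p ⊆ˢ q → ∀ {x y} → x ∈ˢ q → y ∈ˢ q → x ≢ y → x ∉ˢ p → y ∉ˢ p →
              2 + ∣ p ∣ ≤ ∣ q ∣
missing-two {p = p} {q} p⊆q {x} {y} x∈q y∈q x≢y x∉p y∉p = begin
  2 + ∣ p ∣         ≤⟨ s≤s (s≤s (p⊆q⇒∣p∣≤∣q∣ p⊆)) ⟩
  2 + ∣ q - x - y ∣ ≤⟨ s≤s (x∈p⇒∣p-x∣<∣p∣ (x∈p∧x≢y⇒x∈p-y y∈q (x≢y ∘ sym))) ⟩
  1 + ∣ q - x ∣     ≤⟨ x∈p⇒∣p-x∣<∣p∣ x∈q ⟩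
  ∣ q ∣             ∎
  where
  open ≤-Reasoning
  p⊆ : p ⊆ˢ q - x - y
  p⊆ z∈p = x∈p∧x≢y⇒x∈p-y (x∈p∧x≢y⇒x∈p-y (p⊆q z∈p) λ { refl → x∉p z∈p }) λ { refl → y∉p z∈p }

∃-missing-two : (p q : Subset n) → 2 + ∣ p ∩ q ∣ ≤ ∣ q ∣ →
                ∃ λ x → ∃ λ y → x ≢ y × x ∈ˢ q × y ∈ˢ q × x ∉ˢ p × y ∉ˢ p
∃-missing-two p q 2+∣p∩q∣≤∣q∣
  with ⊈⇒∃ q p (λ q⊆p → <⇒≱ 2+∣p∩q∣≤∣q∣ (m≤n⇒m≤1+n (p⊆q⇒∣p∣≤∣q∣ λ z∈q → x∈p∩q⁺ (q⊆p z∈q , z∈q))))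
... | x , x∈q , x∉p
  -- Removing `x` costs only one element, so `p` still does not cover the rest of `q`.
  with ⊈⇒∃ (q - x) p (λ q-x⊆p → <⇒≱ 2+∣p∩q∣≤∣q∣ (≤-trans (∣p∣≤1+∣p-x∣ q x)
         (s≤s (p⊆q⇒∣p∣≤∣q∣ λ z∈ → x∈p∩q⁺ (q-x⊆p z∈ , p─q⊆p q ⁅ x ⁆ z∈)))))
... | y , y∈q-x , y∉p =
  x , y , (λ { refl → x∉p-x q x y∈q-x }) , x∈q , p─q⊆p q ⁅ x ⁆ y∈q-x , x∉p , y∉p

0<card⇒∃ : {𝒫 : Family n} (𝒫? : Decidable 𝒫) → 0 < card 𝒫? → ∃ 𝒫
0<card⇒∃ {n} 𝒫? 0<card with anySubset? 𝒫?
... | yes ∃𝒫 = ∃𝒫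
... | no ¬∃  = contradiction
  (cong length (filter-none 𝒫? (universal (λ A A∈𝒫 → ¬∃ (A , A∈𝒫)) (allSubsets n)))) (m<n⇒n≢0 0<card)

-- Traces on `[1… 2 * k ∸ t ]` of a shifted intersecting family.

module _ {k t : ℕ} {ℱ : Family n} (t<k : t < k) (k<n : k < n) (ℱ⊆Layer : ℱ ⊆ Layer n k)
         (shifted : Shifted ℱ) (intersecting : Intersecting t ℱ) where

  private
    M : Subset n
    M = [1… 2 * k ∸ t ]

    t≤2k : t ≤ 2 * k
    t≤2k = ≤-trans (<⇒≤ t<k) (m≤m+n k _)

    t+2≤2k∸t : t + 2 ≤ 2 * k ∸ t
    t+2≤2k∸t = m+n≤o⇒m≤o∸n (t + 2) (begin
      t + 2 + t         ≡⟨ cong (_+ t) (+-comm t 2) ⟩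
      suc (suc (t + t)) ≡⟨ cong suc (+-suc t t) ⟨
      suc t + suc t     ≤⟨ +-mono-≤ t<k t<k ⟩
      k + k             ≡⟨ cong (k +_) (+-identityʳ k) ⟨
      2 * k             ∎)
      where open ≤-Reasoning

    exchange-∈ : ∀ {F e x} → F ∈ ℱ → e ∈ˢ F → x ∉ˢ F → x <ᶠ e → exchange F e x ∈ ℱ
    exchange-∈ {F} F∈ℱ e∈F x∉F x<e = shifted (exchange-≺ F e∈F x∉F x<e) F∈ℱ

  -- A common element e of F and F′ beyond M can be exchanged in F for an element x of M
  -- outside F ∪ F′; this shrinks F ∩ F′ without changing its trace on M.
  base-intersecting : ∀ {F F′} → F ∈ ℱ → F′ ∈ ℱ → t ≤ ∣ (F ∩ F′) ∩ M ∣
  base-intersecting {F} {F′} F∈ℱ F′∈ℱ = go (suc ∣ F ∩ F′ ∣) F∈ℱ ≤-refl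
    where
    -- `F′` stays fixed, and `c` bounds the size of the shrinking intersection.
    go : ∀ c {F} → F ∈ ℱ → ∣ F ∩ F′ ∣ < c → t ≤ ∣ (F ∩ F′) ∩ M ∣
    go (suc c) {F} F∈ℱ (s≤s ∣F∩F′∣≤c) with t ≤? ∣ (F ∩ F′) ∩ M ∣
    ... | yes t≤ = t≤
    ... | no  t≰ with ⊈⇒∃ (F ∩ F′) M (λ F∩F′⊆M → t≰ (≤-trans (intersecting F∈ℱ F′∈ℱ)
                        (p⊆q⇒∣p∣≤∣q∣ λ z∈ → x∈p∩q⁺ (z∈ , F∩F′⊆M z∈))))
    ...   | e , e∈F∩F′ , e∉M with ⊈⇒∃ M (F ∪ F′) M⊈F∪F′
      where
      e∈F = proj₁ (x∈p∩q⁻ F F′ e∈F∩F′)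

      -- The length of `M` is chosen for this: a union covering `M` and also `e` has more than
      -- `2 * k ∸ t` elements, and the intersection has at least `t`, which exceeds `k + k` in
      -- total.
      M⊈F∪F′ : ¬ (M ⊆ˢ F ∪ F′)
      M⊈F∪F′ M⊆F∪F′ = <-irrefl refl (begin-strict
        2 * k                         ≡⟨ m∸n+n≡m t≤2k ⟨
        2 * k ∸ t + t                 ≡⟨ cong (_+ t) (∣[1…m]∣≡m 2k∸t≤n) ⟨
        ∣ M ∣ + t
          <⟨ +-mono-<-≤ (p⊂q⇒∣p∣<∣q∣ (M⊆F∪F′ , e , p⊆p∪q F′ e∈F , e∉M)) (intersecting F∈ℱ F′∈ℱ) ⟩
        ∣ F ∪ F′ ∣ + ∣ F ∩ F′ ∣       ≡⟨ ∣p∪q∣+∣p∩q∣≡∣p∣+∣q∣ F F′ ⟩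
        ∣ F ∣ + ∣ F′ ∣                ≡⟨ cong₂ _+_ (ℱ⊆Layer F∈ℱ) (ℱ⊆Layer F′∈ℱ) ⟩
        k + k                         ≡⟨ cong (k +_) (+-identityʳ k) ⟨
        2 * k                         ∎)
        where
        open ≤-Reasoning
        -- An element beyond `M` shows that `M` is not truncated.
        2k∸t≤n : 2 * k ∸ t ≤ n
        2k∸t≤n = ≤-trans (≮⇒≥ (e∉M ∘ ∈-[1…]⁺ (2 * k ∸ t))) (<⇒≤ (Fin.toℕ<n e))
    ...     | x , x∈M , x∉F∪F′ =
      ≤-trans (go c F₁∈ℱ (<-≤-trans (p⊂q⇒∣p∣<∣q∣ F₁∩F′⊂F∩F′) ∣F∩F′∣≤c))
              (p⊆q⇒∣p∣≤∣q∣ λ z∈ → x∈p∩q⁺ (F₁∩F′⊆F∩F′ (p∩q⊆p (F₁ ∩ F′) M z∈) , p∩q⊆q (F₁ ∩ F′) M z∈))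
      where
      e∈F = proj₁ (x∈p∩q⁻ F F′ e∈F∩F′)
      x∉F = λ x∈F → x∉F∪F′ (p⊆p∪q F′ x∈F)

      F₁ = exchange F e x

      F₁∈ℱ : F₁ ∈ ℱ
      F₁∈ℱ = exchange-∈ F∈ℱ e∈F x∉F
        (<-≤-trans (∈-[1…]⁻ (2 * k ∸ t) x∈M) (≮⇒≥ (e∉M ∘ ∈-[1…]⁺ (2 * k ∸ t))))

      ∈F₁∩F′⁻ : ∀ {z} → z ∈ˢ F₁ ∩ F′ → (z ∈ˢ F × z ≢ e) × z ∈ˢ F′
      ∈F₁∩F′⁻ z∈ with x∈p∩q⁻ F₁ F′ z∈
      ... | z∈F₁ , z∈F′ = ∈-exchange⁻ z∈F₁ (λ { refl → x∉F∪F′ (q⊆p∪q F F′ z∈F′) }) , z∈F′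

      F₁∩F′⊆F∩F′ : F₁ ∩ F′ ⊆ˢ F ∩ F′
      F₁∩F′⊆F∩F′ z∈ with ∈F₁∩F′⁻ z∈
      ... | (z∈F , _) , z∈F′ = x∈p∩q⁺ (z∈F , z∈F′)

      F₁∩F′⊂F∩F′ : F₁ ∩ F′ ⊂ F ∩ F′
      F₁∩F′⊂F∩F′ = F₁∩F′⊆F∩F′ , e , e∈F∩F′ , λ e∈ → proj₂ (proj₁ (∈F₁∩F′⁻ e∈)) refl

  private
    -- Off `M` nothing changes, and both sets have `k` elements.
    ∣exchange∩M∣ : ∀ {F e x} → F ∈ ℱ → exchange F e x ∈ ℱ → e ∈ˢ M → x ∈ˢ M →
                   ∣ exchange F e x ∩ M ∣ ≡ ∣ F ∩ M ∣
    ∣exchange∩M∣ {F} {e} {x} F∈ℱ F₁∈ℱ e∈M x∈M = +-cancelʳ-≡ ∣ F ∩ ∁ M ∣ _ _ (begin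
      ∣ F₁ ∩ M ∣ + ∣ F ∩ ∁ M ∣    ≡⟨ cong (λ A → ∣ F₁ ∩ M ∣ + ∣ A ∣) F₁∩∁M≡F∩∁M ⟨
      ∣ F₁ ∩ M ∣ + ∣ F₁ ∩ ∁ M ∣   ≡⟨ ∣p∩q∣+∣p∩∁q∣≡∣p∣ F₁ M ⟩
      ∣ F₁ ∣                      ≡⟨ trans (ℱ⊆Layer F₁∈ℱ) (sym (ℱ⊆Layer F∈ℱ)) ⟩
      ∣ F ∣                       ≡⟨ ∣p∩q∣+∣p∩∁q∣≡∣p∣ F M ⟨
      ∣ F ∩ M ∣ + ∣ F ∩ ∁ M ∣     ∎)
      where
      open ≡-Reasoning
      F₁ = exchange F e x

      F₁∩∁M≡F∩∁M : F₁ ∩ ∁ M ≡ F ∩ ∁ M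
      F₁∩∁M≡F∩∁M = ⊆-antisym ⊆₁ ⊆₂
        where
        ⊆₁ : F₁ ∩ ∁ M ⊆ˢ F ∩ ∁ M
        ⊆₁ z∈ with x∈p∩q⁻ F₁ (∁ M) z∈
        ... | z∈F₁ , z∈∁M = x∈p∩q⁺ (proj₁ (∈-exchange⁻ z∈F₁ λ { refl → x∈∁p⇒x∉p z∈∁M x∈M }) , z∈∁M)
        ⊆₂ : F ∩ ∁ M ⊆ˢ F₁ ∩ ∁ M
        ⊆₂ z∈ with x∈p∩q⁻ F (∁ M) z∈
        ... | z∈F , z∈∁M = x∈p∩q⁺ (∈-exchange⁺ z∈F (λ { refl → x∈∁p⇒x∉p z∈∁M e∈M }) , z∈∁M)

    -- By `base-intersecting`, `F` contains at least `t` of the `t + 1` elements of `F₁ ∩ M`, so it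
    -- misses at most one.
    ¬missing-two : ∀ {F F₁ p q} → F ∈ ℱ → F₁ ∈ ℱ → ∣ F₁ ∩ M ∣ ≡ t + 1 →
                   p ∈ˢ M → q ∈ˢ M → p ≢ q → p ∈ˢ F₁ → q ∈ˢ F₁ → p ∉ˢ F → q ∉ˢ F → ⊥
    ¬missing-two {F} {F₁} F∈ℱ F₁∈ℱ ∣F₁∩M∣ p∈M q∈M p≢q p∈F₁ q∈F₁ p∉F q∉F = <-irrefl refl (begin-strict
      t + 1                     ≡⟨ +-comm t 1 ⟩
      1 + t                     <⟨ s≤s (s≤s (base-intersecting F₁∈ℱ F∈ℱ)) ⟩
      2 + ∣ (F₁ ∩ F) ∩ M ∣      ≤⟨ missing-two F₁∩F∩M⊆F₁∩M (x∈p∩q⁺ (p∈F₁ , p∈M)) (x∈p∩q⁺ (q∈F₁ , q∈M)) p≢q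
                                     (p∉F ∘ ∈F) (q∉F ∘ ∈F) ⟩
      ∣ F₁ ∩ M ∣                ≡⟨ ∣F₁∩M∣ ⟩
      t + 1                     ∎)
      where
      open ≤-Reasoning
      ∈F : ∀ {z} → z ∈ˢ (F₁ ∩ F) ∩ M → z ∈ˢ F
      ∈F z∈ = p∩q⊆q F₁ F (p∩q⊆p (F₁ ∩ F) M z∈)

      F₁∩F∩M⊆F₁∩M : (F₁ ∩ F) ∩ M ⊆ˢ F₁ ∩ M
      F₁∩F∩M⊆F₁∩M z∈ = x∈p∩q⁺ (p∩q⊆p F₁ F (p∩q⊆p (F₁ ∩ F) M z∈) , p∩q⊆q (F₁ ∩ F) M z∈)

    -- Compressing base sets of size `t + 1` into `[1… t + 2 ]`.

    N : Subset n
    N = [1… t + 2 ]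

    ∣N∣ : ∣ N ∣ ≡ t + 2
    ∣N∣ = ∣[1…m]∣≡m (≤-trans (≤-reflexive (+-comm t 2)) (≤-trans (s≤s t<k) k<n))

    N⊆M : N ⊆ˢ M
    N⊆M = [1…]-mono t+2≤2k∸t

    -- Each round trades an element of `F ∩ M` beyond `N` for a missing element of `N` other than
    -- `i`; `c` bounds the number still missing. By size, the final trace on `M` is exactly `N - i`.
    fill : ∀ c {F i} → F ∈ ℱ → ∣ F ∩ M ∣ ≡ t + 1 → i ∈ˢ N → i ∉ˢ F → ∣ N ∩ ∁ F ∣ < c →
           ∃ λ F₁ → F₁ ∈ ℱ × ∣ F₁ ∩ M ∣ ≡ t + 1 × (∀ {z} → z ∈ˢ N → z ≢ i → z ∈ˢ F₁) × i ∉ˢ F₁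
    fill (suc c) {F} {i} F∈ℱ ∣F∩M∣ i∈N i∉F (s≤s ∣N∩∁F∣≤c)
      with Fin.any? (λ z → (z ∈? N) ×-dec ¬? (z Fin.≟ i) ×-dec ¬? (z ∈? F))
    ... | no ¬∃ = F , F∈ℱ , ∣F∩M∣ ,
      (λ {z} z∈N z≢i → decidable-stable (z ∈? F) λ z∉F → ¬∃ (z , z∈N , z≢i , z∉F)) , i∉F
    ... | yes (x , x∈N , x≢i , x∉F) with ⊈⇒∃ (F ∩ M) N F∩M⊈N
      where
      -- Without `x` and `i`, only `t` elements of `N` are left for the `t + 1` elements of `F ∩ M`.
      F∩M⊈N : ¬ (F ∩ M ⊆ˢ N)
      F∩M⊈N F∩M⊆N = <-irrefl refl (begin-strict
        t + 2           <⟨ ≤-reflexive (sym (+-suc t 2)) ⟩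
        t + 3           ≡⟨ +-comm t 3 ⟩
        2 + (1 + t)     ≡⟨ cong (2 +_) (+-comm 1 t) ⟩
        2 + (t + 1)     ≡⟨ cong (2 +_) ∣F∩M∣ ⟨
        2 + ∣ F ∩ M ∣   ≤⟨ missing-two F∩M⊆N x∈N i∈N x≢i (x∉F ∘ p∩q⊆p F M) (i∉F ∘ p∩q⊆p F M) ⟩
        ∣ N ∣           ≡⟨ ∣N∣ ⟩
        t + 2           ∎)
        where open ≤-Reasoning
    ...   | e , e∈F∩M , e∉N = fill c F₁∈ℱ
        (trans (∣exchange∩M∣ F∈ℱ F₁∈ℱ (p∩q⊆q F M e∈F∩M) (N⊆M x∈N)) ∣F∩M∣) i∈N
        (λ i∈F₁ → i∉F (proj₁ (∈-exchange⁻ i∈F₁ (x≢i ∘ sym))))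
        (<-≤-trans (p⊂q⇒∣p∣<∣q∣ (N∩∁F₁⊆N∩∁F , x , x∈p∩q⁺ (x∈N , x∉p⇒x∈∁p x∉F)
          , λ x∈ → x∈∁p⇒x∉p (p∩q⊆q N (∁ F₁) x∈) x∈exchange)) ∣N∩∁F∣≤c)
      where
      F₁ = exchange F e x

      F₁∈ℱ : F₁ ∈ ℱ
      F₁∈ℱ = exchange-∈ F∈ℱ (p∩q⊆p F M e∈F∩M) x∉F
        (<-≤-trans (∈-[1…]⁻ (t + 2) x∈N) (≮⇒≥ (e∉N ∘ ∈-[1…]⁺ (t + 2))))

      N∩∁F₁⊆N∩∁F : N ∩ ∁ F₁ ⊆ˢ N ∩ ∁ F
      N∩∁F₁⊆N∩∁F z∈ with x∈p∩q⁻ N (∁ F₁) z∈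
      ... | z∈N , z∈∁F₁ = x∈p∩q⁺ (z∈N , x∉p⇒x∈∁p λ z∈F →
        x∈∁p⇒x∉p z∈∁F₁ (∈-exchange⁺ z∈F λ { refl → e∉N z∈N }))

    -- The last two elements of `N`, with `toℕ` values `t` and `t + 1`, both exceed `i`, and `q` is
    -- at most one of them.
    >i∧≢q : ∀ {i : Fin n} → toℕ i < t → ∀ q → ∃ λ r → i <ᶠ r × r ∈ˢ N × r ≢ q
    >i∧≢q {i} i<t q with fromℕ< t<n Fin.≟ q
      where
      t<n = <-trans t<k k<n
    ... | no  r≢q  = _ , subst (toℕ i <_) (sym (Fin.toℕ-fromℕ< _)) i<t ,
                     ∈-[1…]⁺ (t + 2) (subst (_< t + 2) (sym (Fin.toℕ-fromℕ< _)) (m<m+n t (s≤s z≤n))) , r≢q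
    ... | yes refl = fromℕ< 1+t<n , subst (toℕ i <_) (sym (Fin.toℕ-fromℕ< _)) (m<n⇒m<1+n i<t) ,
                     ∈-[1…]⁺ (t + 2) (subst₂ _<_ (sym (Fin.toℕ-fromℕ< _)) (+-comm 2 t) ≤-refl) ,
                     λ eq → 1+n≢n (Fin.fromℕ<-injective _ _ 1+t<n _ eq)
      where
      1+t<n = ≤-<-trans t<k k<n

    -- The element `r` is where the compressed set will have its hole in `N`, leaving `p` and `q`
    -- present. It is `i` itself if possible; otherwise `i` is one of the pair, and only the other
    -- has to be avoided above `i`.
    pick : ∀ {i} → toℕ i < t → ∀ {p q : Fin n} → p ≢ q →
           ∃ λ r → r ≢ p × r ≢ q × (r ≡ i ⊎ i <ᶠ r × r ∈ˢ N)
    pick {i} i<t {p} {q} p≢q with i Fin.≟ p | i Fin.≟ q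
    ... | no i≢p   | no i≢q   = i , i≢p , i≢q , inj₁ refl
    ... | yes refl | _        with >i∧≢q i<t q
    ...   | r , i<r , r∈N , r≢q = r , Fin.<⇒≢ i<r ∘ sym , r≢q , inj₂ (i<r , r∈N)
    pick {i} i<t {p} {q} p≢q | no _     | yes refl with >i∧≢q i<t p
    ...   | r , i<r , r∈N , r≢p = r , r≢p , Fin.<⇒≢ i<r ∘ sym , inj₂ (i<r , r∈N)

  -- A base set of size t + 1 missing some i ≤ t can be compressed to [t + 2] ∖ {r} for every
  -- r ≥ i outside a given pair {p , q}, so no member of ℱ misses two elements of [t + 2].
  [1…t]⊆ : ℱ ⊈ 𝒜₁ n k t → ∀ {F} → F ∈ ℱ → ∣ F ∩ M ∣ ≡ t + 1 → [1… t ] ⊆ˢ F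
  [1…t]⊆ ℱ⊈𝒜₁ {F₀} F₀∈ℱ ∣F₀∩M∣ {i} i∈T =
    decidable-stable (i ∈? F₀) λ i∉F₀ → ℱ⊈𝒜₁ λ F∈ℱ → ℱ⊆Layer F∈ℱ ,
      ≮⇒≥ λ ∣F∩N∣<t+1 → ⊥-elim (impossible i∉F₀ F∈ℱ ∣F∩N∣<t+1)
    where
    i<t : toℕ i < t
    i<t = ∈-[1…]⁻ t i∈T

    i∈N : i ∈ˢ N
    i∈N = [1…]-mono (m≤m+n t 2) i∈T

    impossible : i ∉ˢ F₀ → ∀ {F} → F ∈ ℱ → ∣ F ∩ N ∣ < t + 1 → ⊥
    impossible i∉F₀ {F} F∈ℱ ∣F∩N∣<t+1
      with fill (suc ∣ N ∩ ∁ F₀ ∣) F₀∈ℱ ∣F₀∩M∣ i∈N i∉F₀ ≤-refl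
         | ∃-missing-two F N (≤-trans (s≤s ∣F∩N∣<t+1) (≤-reflexive (trans (sym (+-suc t 1)) (sym ∣N∣))))
    ... | F₁ , F₁∈ℱ , ∣F₁∩M∣ , N-i⊆F₁ , i∉F₁ | p , q , p≢q , p∈N , q∈N , p∉F , q∉F
      with pick i<t p≢q
    ...   | r , r≢p , r≢q , inj₁ refl =
      ¬missing-two F∈ℱ F₁∈ℱ ∣F₁∩M∣ (N⊆M p∈N) (N⊆M q∈N) p≢q
        (N-i⊆F₁ p∈N (r≢p ∘ sym)) (N-i⊆F₁ q∈N (r≢q ∘ sym)) p∉F q∉F
    ...   | r , r≢p , r≢q , inj₂ (i<r , r∈N) =
      ¬missing-two F∈ℱ F₂∈ℱ (trans (∣exchange∩M∣ F₁∈ℱ F₂∈ℱ (N⊆M r∈N) (N⊆M i∈N)) ∣F₁∩M∣)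
        (N⊆M p∈N) (N⊆M q∈N) p≢q (∈F₂ p∈N (r≢p ∘ sym)) (∈F₂ q∈N (r≢q ∘ sym)) p∉F q∉F
      where
      -- The hole moves from `i` up to `r`.
      F₂ = exchange F₁ r i

      F₂∈ℱ : F₂ ∈ ℱ
      F₂∈ℱ = exchange-∈ F₁∈ℱ (N-i⊆F₁ r∈N (Fin.<⇒≢ i<r ∘ sym)) i∉F₁ i<r

      ∈F₂ : ∀ {z} → z ∈ˢ N → z ≢ r → z ∈ˢ F₂
      ∈F₂ {z} z∈N z≢r with z Fin.≟ i
      ... | yes refl = x∈exchange
      ... | no  z≢i  = ∈-exchange⁺ (N-i⊆F₁ z∈N z≢i) z≢r

  -- Consequences of a base set containing `[1… t ]` and reaching beyond `2t`.

  module _ {F₀ : Subset n} (F₀∈ℱ : F₀ ∈ ℱ) (∣F₀∩M∣ : ∣ F₀ ∩ M ∣ ≡ t + 1) (T⊆F₀ : [1… t ] ⊆ˢ F₀)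
           {y : Fin n} (y∈F₀ : y ∈ˢ F₀) (y∈M : y ∈ˢ M) (2t≤y : t + t ≤ toℕ y) where

    private
      T X : Subset n
      T = [1… t ]
      X = [1… t + t + 1 ]

      y∉T : y ∉ˢ T
      y∉T y∈T = <⇒≱ (∈-[1…]⁻ t y∈T) (≤-trans (m≤m+n t t) 2t≤y)

      T⊆M : T ⊆ˢ M
      T⊆M = [1…]-mono (m+n≤o⇒m≤o t t+2≤2k∸t)

      T⊆X : T ⊆ˢ X
      T⊆X = [1…]-mono (≤-trans (m≤m+n t t) (m≤m+n _ 1))

      -- As `toℕ` counts from zero, `t + t ≤ toℕ y` puts `y` at or beyond `2t + 1`, the last element
      -- of `X`.
      ≤y : ∀ {z} → z ∈ˢ X → toℕ z ≤ toℕ y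
      ≤y {z} z∈X = ≤-trans (s≤s⁻¹ (subst (toℕ z <_) (+-comm (t + t) 1) (∈-[1…]⁻ (t + t + 1) z∈X))) 2t≤y

      X⊆M : X ⊆ˢ M
      X⊆M z∈X = ∈-[1…]⁺ (2 * k ∸ t) (≤-<-trans (≤y z∈X) (∈-[1…]⁻ (2 * k ∸ t) y∈M))

      -- T ∪ {z} is a base set for every z ∈ X ∖ T.
      X-i⊆ : ∀ {F} → F ∈ ℱ → ∀ {i} → i ∈ˢ T → i ∉ˢ F → ∀ {z} → z ∈ˢ X → z ≢ i → z ∈ˢ F
      X-i⊆ {F} F∈ℱ {i} i∈T i∉F {z} z∈X z≢i = decidable-stable (z ∈? F) z∉F⇒⊥
        where
        z∉F⇒⊥ : ¬ (z ∉ˢ F)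
        z∉F⇒⊥ z∉F with z ∈? F₀
        ... | yes z∈F₀ = ¬missing-two F∈ℱ F₀∈ℱ ∣F₀∩M∣ (X⊆M z∈X) (T⊆M i∈T) z≢i z∈F₀ (T⊆F₀ i∈T) z∉F i∉F
        ... | no  z∉F₀ = ¬missing-two F∈ℱ F₁∈ℱ (trans (∣exchange∩M∣ F₀∈ℱ F₁∈ℱ y∈M (X⊆M z∈X)) ∣F₀∩M∣)
            (X⊆M z∈X) (T⊆M i∈T) z≢i x∈exchange
            (∈-exchange⁺ (T⊆F₀ i∈T) λ { refl → y∉T i∈T }) z∉F i∉F
          where
          F₁∈ℱ : exchange F₀ y z ∈ ℱ
          F₁∈ℱ = exchange-∈ F₀∈ℱ y∈F₀ z∉F₀ (Fin.≤∧≢⇒< (≤y z∈X) λ { refl → z∉F₀ y∈F₀ })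

      2t+1≤n : t + t + 1 ≤ n
      2t+1≤n = subst (_≤ n) (+-comm 1 (t + t)) (≤-<-trans 2t≤y (Fin.toℕ<n y))

      -- A member missing some `i` of `T` contains the other `t + t` elements of `X` by `X-i⊆`.
      dichotomy : ∀ {F} → F ∈ ℱ → T ⊆ˢ F ⊎ t + t ≤ ∣ F ∩ X ∣
      dichotomy {F} F∈ℱ with T ⊆? F
      ... | yes T⊆F = inj₁ T⊆F
      ... | no  T⊈F with ⊈⇒∃ T F T⊈F
      ...   | i , i∈T , i∉F = inj₂ (s≤s⁻¹ (begin
        suc (t + t)      ≡⟨ +-comm 1 (t + t) ⟩
        t + t + 1        ≡⟨ ∣[1…m]∣≡m 2t+1≤n ⟨
        ∣ X ∣            ≤⟨ ∣p∣≤1+∣p-x∣ X i ⟩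
        suc ∣ X - i ∣    ≤⟨ s≤s (p⊆q⇒∣p∣≤∣q∣ X-i⊆F∩X) ⟩
        suc ∣ F ∩ X ∣    ∎))
        where
        open ≤-Reasoning
        X-i⊆F∩X : X - i ⊆ˢ F ∩ X
        X-i⊆F∩X {z} z∈ = x∈p∩q⁺ (X-i⊆ F∈ℱ i∈T i∉F z∈X (λ { refl → x∉p-x X z z∈ }) , z∈X)
          where z∈X = p─q⊆p X ⁅ i ⁆ z∈

      -- The extra shadow set is sought between `A` and `E`: it avoids `y`, and differs from `E`
      -- only inside `T`.
      E A : Subset n
      E = F₀ - y
      A = E ∩ ∁ T

      E⊆F₀ : E ⊆ˢ F₀
      E⊆F₀ = p─q⊆p F₀ ⁅ y ⁆

      ∣T∣≡t : ∣ T ∣ ≡ t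
      ∣T∣≡t = ∣[1…m]∣≡m (<⇒≤ (<-trans t<k k<n))

      E∩T≡T : E ∩ T ≡ T
      E∩T≡T = ⊆-antisym (p∩q⊆q E T)
        λ z∈T → x∈p∩q⁺ (x∈p∧x≢y⇒x∈p-y (T⊆F₀ z∈T) (λ { refl → y∉T z∈T }) , z∈T)

      ∣E∣≡∣A∣+t : ∣ E ∣ ≡ ∣ A ∣ + t
      ∣E∣≡∣A∣+t = begin
        ∣ E ∣                      ≡⟨ ∣p∩q∣+∣p∩∁q∣≡∣p∣ E T ⟨
        ∣ E ∩ T ∣ + ∣ E ∩ ∁ T ∣    ≡⟨ cong (_+ ∣ A ∣) (trans (cong ∣_∣ E∩T≡T) ∣T∣≡t) ⟩
        t + ∣ A ∣                  ≡⟨ +-comm t _ ⟩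
        ∣ A ∣ + t                  ∎
        where open ≡-Reasoning

      k≡1+∣E∣ : k ≡ suc ∣ E ∣
      k≡1+∣E∣ = trans (sym (ℱ⊆Layer F₀∈ℱ)) (≤-antisym (∣p∣≤1+∣p-x∣ F₀ y) (x∈p⇒∣p-x∣<∣p∣ y∈F₀))

    card-shadow-of-wide-base : ∀ {j} → 1 ≤ j → j < t → (ℱ? : Decidable ℱ) →
                               (t C j) * card ℱ? < card (shadow? k j ℱ?)
    card-shadow-of-wide-base {j} 1≤j j<t ℱ? = result
      where
      -- This many elements of `T` are kept when `y` and `j ∸ 1` elements of `T` are deleted;
      -- `1 ≤ j` makes it at most `t`.
      s = suc (t ∸ j)

      s≤t : s ≤ t
      s≤t = ∸-monoʳ-< 1≤j (<⇒≤ j<t)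

      s+j≡1+t : s + j ≡ suc t
      s+j≡1+t = cong suc (m∸n+n≡m (<⇒≤ j<t))

      G₀-exists : ∃ (Between A E (∣ A ∣ + s))
      G₀-exists = 0<card⇒∃ (between? A E (∣ A ∣ + s)) (begin
        1                               ≡⟨ nCn≡1 s ⟨
        s C s                           ≤⟨ C-monoˡ-≤ s s≤t ⟩
        t C s                           ≡⟨ card-between A E (p∩q⊆p E (∁ T)) ∣E∣≡∣A∣+t s ⟨
        card (between? A E (∣ A ∣ + s)) ∎)
        where open ≤-Reasoning

      result : (t C j) * card ℱ? < card (shadow? k j ℱ?)
      result with G₀-exists
      ... | G₀ , A⊆G₀ , G₀⊆E , ∣G₀∣ =
        card-shadow-> j<t T⊆X ∣T∣≡t (∣[1…m]∣≤m n _) ℱ? dichotomy (shadow? k j ℱ?)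
          (λ {F} F∈ℱ ∣F∣ G⊆F → ∸-of-+ (trans (sym (ℱ⊆Layer F∈ℱ)) ∣F∣) , F , F∈ℱ , G⊆F)
          (∸-of-+ k≡∣G₀∣+j , F₀ , F₀∈ℱ , λ z∈ → E⊆F₀ (G₀⊆E z∈))
          t<∣G₀∩T∣+j ∣G₀∩X∣+j<2t
        where
        open ≤-Reasoning
        ∸-of-+ : ∀ {m} → k ≡ m + j → m ≡ k ∸ j
        ∸-of-+ {m} k≡m+j = trans (sym (m+n∸n≡m m j)) (cong (_∸ j) (sym k≡m+j))

        k≡∣G₀∣+j : k ≡ ∣ G₀ ∣ + j
        k≡∣G₀∣+j = begin-equality
          k                 ≡⟨ k≡1+∣E∣ ⟩
          suc ∣ E ∣         ≡⟨ cong suc ∣E∣≡∣A∣+t ⟩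
          suc (∣ A ∣ + t)   ≡⟨ +-suc ∣ A ∣ t ⟨
          ∣ A ∣ + suc t     ≡⟨ cong (∣ A ∣ +_) s+j≡1+t ⟨
          ∣ A ∣ + (s + j)   ≡⟨ +-assoc ∣ A ∣ s j ⟨
          ∣ A ∣ + s + j     ≡⟨ cong (_+ j) ∣G₀∣ ⟨
          ∣ G₀ ∣ + j        ∎

        t<∣G₀∩T∣+j : t < ∣ G₀ ∩ T ∣ + j
        t<∣G₀∩T∣+j = subst (_≤ ∣ G₀ ∩ T ∣ + j) s+j≡1+t (+-monoˡ-≤ j (+-cancelˡ-≤ ∣ A ∣ _ _ (begin
          ∣ A ∣ + s                     ≡⟨ ∣G₀∣ ⟨
          ∣ G₀ ∣                        ≡⟨ ∣p∩q∣+∣p∩∁q∣≡∣p∣ G₀ T ⟨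
          ∣ G₀ ∩ T ∣ + ∣ G₀ ∩ ∁ T ∣     ≤⟨ +-monoʳ-≤ _ (p⊆q⇒∣p∣≤∣q∣ λ z∈ →
                                             x∈p∩q⁺ (G₀⊆E (p∩q⊆p G₀ (∁ T) z∈) , p∩q⊆q G₀ (∁ T) z∈)) ⟩
          ∣ G₀ ∩ T ∣ + ∣ A ∣            ≡⟨ +-comm _ ∣ A ∣ ⟩
          ∣ A ∣ + ∣ G₀ ∩ T ∣            ∎)))

        -- The trace lies in `F₀ ∩ M`, of size `t + 1`, and misses its element `y`.
        ∣G₀∩X∣≤t : ∣ G₀ ∩ X ∣ ≤ t
        ∣G₀∩X∣≤t = s≤s⁻¹ (begin-strict
          ∣ G₀ ∩ X ∣   <⟨ p⊂q⇒∣p∣<∣q∣ (G₀∩X⊆F₀∩M , y , x∈p∩q⁺ (y∈F₀ , y∈M) ,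
                            λ y∈ → x∉p-x F₀ y (G₀⊆E (p∩q⊆p G₀ X y∈))) ⟩
          ∣ F₀ ∩ M ∣   ≡⟨ trans ∣F₀∩M∣ (+-comm t 1) ⟩
          suc t        ∎)
          where
          G₀∩X⊆F₀∩M : G₀ ∩ X ⊆ˢ F₀ ∩ M
          G₀∩X⊆F₀∩M z∈ = x∈p∩q⁺ (E⊆F₀ (G₀⊆E (p∩q⊆p G₀ X z∈)) , X⊆M (p∩q⊆q G₀ X z∈))

        ∣G₀∩X∣+j<2t : ∣ G₀ ∩ X ∣ + j < t + t
        ∣G₀∩X∣+j<2t = +-mono-≤-< ∣G₀∩X∣≤t j<t

  -- Finding a base set that reaches beyond `2t`, and the conclusion.

  -- Only `t` sets of size `t + 1` at most lie between `[1… t ]` and `[1… t + t ]`, so some base set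
  -- of that size is not among them. It contains `[1… t ]` by `[1…t]⊆`, hence has an element beyond
  -- `2t`.
  ∃-wide-base : ℱ ⊈ 𝒜₁ n k t → (ℱ? : Decidable ℱ) → t + 1 ≤ b k t ℱ? (t + 1) →
    ∃ λ F → F ∈ ℱ × ∣ F ∩ M ∣ ≡ t + 1 × ∃ λ y → y ∈ˢ F × y ∈ˢ M × t + t ≤ toℕ y
  ∃-wide-base ℱ⊈𝒜₁ ℱ? t+1≤b
    with anySubset? (λ B → baseLayer? k t ℱ? (t + 1) B
                             ×-dec ¬? (between? [1… t ] [1… t + t ] (t + 1) B))
  ... | no ¬∃ = contradiction t+1≤b (<⇒≱ (begin-strict
    b k t ℱ? (t + 1)
      ≤⟨ count-mono (baseLayer? k t ℱ? (t + 1)) (between? T [1… t + t ] (t + 1))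
           (λ {B} B∈ → decidable-stable (between? T [1… t + t ] (t + 1) B) λ B∉ → ¬∃ (B , B∈ , B∉))
           (allSubsets n) ⟩
    card (between? T [1… t + t ] (t + 1))
      ≡⟨ cong (λ m → card (between? T [1… t + t ] (m + 1))) ∣T∣≡t ⟨
    card (between? T [1… t + t ] (∣ T ∣ + 1))
      ≡⟨ card-between T [1… t + t ] T⊆[1…2t] (sym (m+[n∸m]≡n (p⊆q⇒∣p∣≤∣q∣ T⊆[1…2t]))) 1 ⟩
    d C 1
      ≡⟨ nC1≡n d ⟩
    d
      -- Only an inequality, as `[1… t + t ]` may be truncated at `n`.
      ≤⟨ m≤n+o⇒m∸n≤o _ ∣ T ∣
           (subst (λ m → ∣ [1…_] {n} (t + t) ∣ ≤ m + t) (sym ∣T∣≡t) (∣[1…m]∣≤m n (t + t))) ⟩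
    t
      <⟨ m<m+n t (s≤s z≤n) ⟩
    t + 1 ∎))
    where
    open ≤-Reasoning
    T : Subset n
    T = [1… t ]
    d = ∣ [1…_] {n} (t + t) ∣ ∸ ∣ T ∣
    ∣T∣≡t : ∣ T ∣ ≡ t
    ∣T∣≡t = ∣[1…m]∣≡m (<⇒≤ (<-trans t<k k<n))
    T⊆[1…2t] : T ⊆ˢ [1… t + t ]
    T⊆[1…2t] = [1…]-mono (m≤m+n t t)
  ... | yes (B , ((F , F∈ℱ , refl) , ∣B∣) , B∉)
    with ⊈⇒∃ (F ∩ M) [1… t + t ] (λ B⊆ → B∉ (T⊆B , B⊆ , ∣B∣))
    where
    T⊆B : [1… t ] ⊆ˢ F ∩ M
    T⊆B z∈ = x∈p∩q⁺ ([1…t]⊆ ℱ⊈𝒜₁ F∈ℱ ∣B∣ z∈ , [1…]-mono (m+n≤o⇒m≤o t t+2≤2k∸t) z∈)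
  ...   | y , y∈B , y∉ =
    F , F∈ℱ , ∣B∣ , y , p∩q⊆p F M y∈B , p∩q⊆q F M y∈B , ≮⇒≥ (y∉ ∘ ∈-[1…]⁺ (t + t))

theorem6p7 : ∀ {n k t j : ℕ} →
    n > k → k > t → t > j → j ≥ 1 →
    n ≥ (k ∸ t + 1) * (t + 1) →
    {ℱ : Family n} (ℱ? : Decidable ℱ) →
    ℱ ⊆ Layer n k →
    Shifted ℱ →
    Intersecting t ℱ →
    ℱ ⊈ 𝒜₁ n k t →
    b k t ℱ? (t + 1) ≥ t + 1 →
    card (shadow? k j ℱ?) > (t C j) * card ℱ?
theorem6p7 k<n t<k j<t 1≤j _ ℱ? ℱ⊆Layer shifted intersecting ℱ⊈𝒜₁ t+1≤b
  with ∃-wide-base t<k k<n ℱ⊆Layer shifted intersecting ℱ⊈𝒜₁ ℱ? t+1≤b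
... | F₀ , F₀∈ℱ , ∣F₀∩M∣ , y , y∈F₀ , y∈M , 2t≤y =
  card-shadow-of-wide-base t<k k<n ℱ⊆Layer shifted intersecting F₀∈ℱ ∣F₀∩M∣
    ([1…t]⊆ t<k k<n ℱ⊆Layer shifted intersecting ℱ⊈𝒜₁ F₀∈ℱ ∣F₀∩M∣)
    y∈F₀ y∈M 2t≤y 1≤j j<t ℱ?
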